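{- Let $n\ge 3$ and let $BS_n$ be the $n$-dimensional bubble-sort star graph. Then $BS_n$ is $(2n-5)$-edge-fault-tolerant strongly Menger edge connected, i.e., for every $F_e\subseteq E(BS_n)$ with $|F_e|\le 2n-5$, the graph $BS_n-F_e$ is strongly Menger edge connected. Moreover, the bound $2n-5$ is sharp: there exists $F_e\subseteq E(BS_n)$ with $|F_e|=2n-4$ such that $BS_n-F_e$ is not strongly Menger edge connected.
   Context: The $n$-dimensional bubble-sort star graph $BS_n$ has as vertex set all permutations $x=x_1x_2\cdots x_n$ of $\{1,\dots,n\}$. Two distinct vertices $x,y$ are adjacent iff there is $k\in\{2,\dots,n\}$ such that $y$ is obtained from $x$ either by swapping the entries in positions $k-1$ and $k$, or by swapping the entries in positions $1$ and $k$. ($BS_n$ is bipartite and $(2n-3)$-regular with $n!$ vertices.) For $F_e\subseteq E(G)$, $G-F_e$ is the graph with vertex set $V(G)$ and edge set $E(G)\setminus F_e$. A graph $G$ is strongly Menger edge connected if for any two distinct vertices $u,v$ of $G$ there exist $\min\{d_G(u),d_G(v)\}$ pairwise edge-disjoint $(u,v)$-paths in $G$. For an integer $m\ge1$, $G$ is $m$-edge-fault-tolerant strongly Menger edge connected if $G-F_e$ is strongly Menger edge connected for every $F_e\subseteq E(G)$ with $|F_e|\le m$. -}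

module Defs where

open import Data.Nat using (ℕ; zero; suc; _<_; _⊓_)
open import Data.Fin using (Fin; toℕ)
open import Data.Vec using (Vec; lookup; _[_]≔_)
open import Data.List using (List; []; _∷_; length)
open import Data.List.Membership.Propositional using (_∈_)
open import Data.List.Relation.Unary.All using (All)
open import Data.List.Relation.Unary.Unique.Propositional using (Unique)
open import Data.List.Relation.Unary.AllPairs using (AllPairs)
open import Data.Product using (Σ; _×_; _,_)
open import Data.Sum using (_⊎_)
open import Relation.Nullary using (¬_)
open import Relation.Binary.PropositionalEquality using (_≡_; _≢_)

-- Arrangements x = x₁ x₂ … xₙ, stored 0-based: position p ∈ Fin n, value in Fin n
-- (value v stands for v+1 ∈ {1,…,n}).
Word : ℕ → Set
Word n = Vec (Fin n) n

IsPerm : ∀ {n} → Word n → Set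
IsPerm {n} x = ∀ (i j : Fin n) → lookup x i ≡ lookup x j → i ≡ j

swap : ∀ {n} → Fin n → Fin n → Word n → Word n
swap i j x = (x [ i ]≔ lookup x j) [ j ]≔ lookup x i

-- Allowed transpositions of BS_n (0-based positions):
--   (k-2, k-1) for k ∈ {2,…,n}   i.e. j = i + 1;
--   (0,   k-1) for k ∈ {2,…,n}   i.e. i = 0, j ≥ 1.
AllowedSwap : ∀ {n} → Fin n → Fin n → Set
AllowedSwap i j = (toℕ j ≡ suc (toℕ i)) ⊎ (toℕ i ≡ 0 × 0 < toℕ j)

Adj : ∀ {n} → Word n → Word n → Set
Adj {n} x y = x ≢ y × Σ (Fin n) λ i → Σ (Fin n) λ j → AllowedSwap i j × y ≡ swap i j x

Edge : ℕ → Set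
Edge n = Word n × Word n

SameEdge : ∀ {n} → Edge n → Edge n → Set
SameEdge (a , b) (c , d) = (a ≡ c × b ≡ d) ⊎ (a ≡ d × b ≡ c)

FaultSet : ∀ {n} → List (Edge n) → Set
FaultSet F = All (λ e → IsPerm (Data.Product.proj₁ e) × Adj (Data.Product.proj₁ e) (Data.Product.proj₂ e)) F

-- the list lists pairwise distinct edges (so |F_e| = length F)
NoDupEdges : ∀ {n} → List (Edge n) → Set
NoDupEdges F = AllPairs (λ e e' → ¬ SameEdge e e') F

Faulty : ∀ {n} → List (Edge n) → Word n → Word n → Set
Faulty F x y = (x , y) ∈ F ⊎ (y , x) ∈ F

AdjF : ∀ {n} → List (Edge n) → Word n → Word n → Set
AdjF F x y = Adj x y × ¬ Faulty F x y

Degree : ∀ {n} → List (Edge n) → Word n → ℕ → Set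
Degree {n} F x d = Σ (List (Word n)) λ L →
  Unique L × length L ≡ d × (∀ y → (y ∈ L → AdjF F x y) × (AdjF F x y → y ∈ L))

data Walk {n} (F : List (Edge n)) : Word n → Word n → Set where
  stop : ∀ {u} → Walk F u u
  step : ∀ {u w v} → AdjF F u w → Walk F w v → Walk F u v

vertices : ∀ {n} {F : List (Edge n)} {u v} → Walk F u v → List (Word n)
vertices {u = u} stop = u ∷ []
vertices {u = u} (step _ p) = u ∷ vertices p

edges : ∀ {n} {F : List (Edge n)} {u v} → Walk F u v → List (Edge n)
edges stop = []
edges {u = u} (step {w = w} _ p) = (u , w) ∷ edges p

Path : ∀ {n} → List (Edge n) → Word n → Word n → Set
Path F u v = Σ (Walk F u v) λ p → Unique (vertices p)

EdgeDisjoint : ∀ {n} {F : List (Edge n)} {u v} → Path F u v → Path F u v → Set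
EdgeDisjoint (p , _) (q , _) =
  ∀ e e' → e ∈ edges p → e' ∈ edges q → ¬ SameEdge e e'

StronglyMengerEC : (n : ℕ) → List (Edge n) → Set
StronglyMengerEC n F =
  ∀ (u v : Word n) → IsPerm u → IsPerm v → u ≢ v →
  ∀ du dv → Degree F u du → Degree F v dv →
  Σ (List (Path F u v)) λ ps → length ps ≡ du ⊓ dv × AllPairs EdgeDisjoint ps

{-# OPTIONS --safe #-}

-- By Menger's theorem for edges it suffices that every edge cut of BSₙ - F separating u from v has
-- at least min (d u) (d v) edges. If one side of the cut is a single vertex, the cut consists of all
-- edges at u or all edges at v. Otherwise the cut has at least 4n - 8 edges in BSₙ, of which at
-- least (4n - 8) - (2n - 5) = 2n - 3 survive. The bound 4n - 8 is proved by induction on n: BSₙ is the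
-- union of n copies of BSₙ₋₁, indexed by the last entry, any two of which are joined by at least
-- four edges, and each vertex has two neighbours outside its copy, in different copies.
module Submission where

-- The constant 4n - 8 is the number of edges leaving the two ends of a single edge: each end keeps
-- 2n - 4 of its 2n - 3 edges. The obstacle in the induction is that a cut may be constant on a
-- copy, where the induction hypothesis says nothing. This forces a division: either some copy lies
-- wholly on one side and some copy wholly on the other, and the many edges between such copies are
-- counted; or one of the sides contains no whole copy, so that every copy it meets is genuinely
-- split and contributes at least the degree of BSₙ₋₁. The copies are not rewritten as graphs on
-- shorter words. All words keep the length n, and a parameter `m` bounds the positions that may be
-- moved, so the induction varies `m` inside one fixed type.

open import Defs
open import Data.Bool using (Bool; true; false; not; if_then_else_)
import Data.Bool.Properties as Bool
open import Data.Empty using (⊥; ⊥-elim)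
open import Data.Fin using (Fin; zero; suc; toℕ; fromℕ<; inject≤; punchOut; #_)
open import Data.Fin.Permutation.Components using (transpose; transpose-inverse)
import Data.Fin.Properties as Fin
open import Data.List using (List; []; _∷_; _++_; map; length; filter; allFin; tabulate; cartesianProduct; cartesianProductWith)
open import Data.List.Properties using (length-map; length-++; length-tabulate)
import Data.List.Membership.DecPropositional as DecMembership
open import Data.List.Membership.Propositional using (_∈_; _∉_; find; lose)
open import Data.List.Membership.Propositional.Properties
  using (∈-∃++; ∈-allFin; ∈-++⁺ˡ; ∈-++⁺ʳ; ∈-++⁻; ∈-map⁺; ∈-map⁻; ∈-filter⁻; ∈-cartesianProduct⁻; ∈-cartesianProductWith⁺)
open import Data.List.Relation.Binary.Permutation.Propositional using (_↭_; ↭-refl; ↭-sym; ↭-trans; prep; ↭⇒↭ₛ)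
open import Data.List.Relation.Binary.Permutation.Propositional.Properties
  using (shift; map⁺; ↭-length; ∈-resp-↭; All-resp-↭)
import Data.List.Relation.Binary.Permutation.Setoid.Properties as ↭ₛ
open import Data.List.Relation.Unary.All as All using (All; []; _∷_)
import Data.List.Relation.Unary.All.Properties as All
open import Data.List.Relation.Unary.AllPairs as AllPairs using (AllPairs; []; _∷_)
import Data.List.Relation.Unary.AllPairs.Properties as AllPairs
open import Data.List.Relation.Unary.Any as Any using (here; there)
import Data.List.Relation.Unary.Unique.DecPropositional as DecUnique
open import Data.List.Relation.Unary.Unique.Propositional using (Unique)
import Data.List.Relation.Unary.Unique.Propositional.Properties as Unique
open import Data.Nat using (ℕ; zero; suc; _+_; _*_; _∸_; _⊓_; _≤_; _<_; z≤n; s≤s; s≤s⁻¹)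
open import Data.Nat.ListAction using (sum)
open import Data.Nat.ListAction.Properties using (sum-↭)
import Data.Nat.Properties as ℕ
open import Data.Nat.Tactic.RingSolver using (solve-∀)
open import Data.Product as Product using (Σ; ∃; _×_; _,_; proj₁; proj₂)
open import Data.Product.Properties using (,-injectiveˡ; ,-injectiveʳ; ≡-dec)
open import Data.Sum as Sum using (_⊎_; inj₁; inj₂; [_,_]′)
open import Data.Vec as Vec using (Vec; []; _∷_; lookup; _[_]≔_)
import Data.Vec.Properties as Vec
open import Function using (_∘_; id)
open import Relation.Binary.Definitions using (Symmetric; DecidableEquality)
open import Relation.Binary.PropositionalEquality
open import Relation.Nullary using (¬_; Dec; yes; no; does; contradiction)
open import Relation.Nullary.Decidable
  using (¬?; _×-dec_; _⊎-dec_; _→-dec_; map′; decidable-stable; dec-true; dec-false; from-yes)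
open import Relation.Unary using (Decidable)

-- Counting distinct witnesses

extract : ∀ {A : Set} {a : A} {xs} → a ∈ xs → ∃ λ ys → xs ↭ a ∷ ys
extract {a = a} p with ys , zs , refl ← ∈-∃++ p = ys ++ zs , shift a ys zs

AllPairs-resp-↭ : ∀ {A : Set} {R : A → A → Set} → Symmetric R →
  ∀ {xs ys} → xs ↭ ys → AllPairs R xs → AllPairs R ys
AllPairs-resp-↭ {A} {R} R-sym = ↭ₛ.AllPairs-resp-↭ (setoid A) R-sym ((λ { refl r → r }) , (λ { refl r → r })) ∘ ↭⇒↭ₛ

Unique-resp-↭ : ∀ {A : Set} {xs ys : List A} → xs ↭ ys → Unique xs → Unique ys
Unique-resp-↭ = AllPairs-resp-↭ ≢-sym

∈-extract-≢ : ∀ {A : Set} {a : A} {xs ys : List A} → xs ↭ a ∷ ys →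
  ∀ {b} → b ∈ xs → b ≢ a → b ∈ ys
∈-extract-≢ σ p b≢a with ∈-resp-↭ σ p
... | here b≡a = contradiction b≡a b≢a
... | there q  = q

Unique-⊆⇒length≤ : ∀ {A : Set} {xs ys : List A} → Unique xs → (∀ {a} → a ∈ xs → a ∈ ys) →
  length xs ≤ length ys
Unique-⊆⇒length≤ []             sub = z≤n
Unique-⊆⇒length≤ (x∉xs ∷ uxs) sub with ys′ , σ ← extract (sub (here refl)) =
  subst (_ ≤_) (sym (↭-length σ))
    (s≤s (Unique-⊆⇒length≤ uxs λ a∈ → ∈-extract-≢ σ (sub (there a∈)) (≢-sym (All.lookup x∉xs a∈))))

AtLeast : {A : Set} → ℕ → (A → Set) → Set
AtLeast {A} k P = Σ (List A) λ L → Unique L × All P L × k ≤ length L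

one : ∀ {A : Set} {P : A → Set} (a : A) → P a → AtLeast 1 P
one a pa = a ∷ [] , [] ∷ [] , pa ∷ [] , s≤s z≤n

AtLeast-mono : ∀ {A : Set} {k l} {P Q : A → Set} → l ≤ k → (∀ a → P a → Q a) → AtLeast k P → AtLeast l Q
AtLeast-mono l≤k P⊆Q (L , u , ps , k≤) = L , u , All.map (P⊆Q _) ps , ℕ.≤-trans l≤k k≤

AtLeast-⊎ : ∀ {A : Set} {k l} {P Q : A → Set} → (∀ a → P a → Q a → ⊥) →
  AtLeast k P → AtLeast l Q → AtLeast (k + l) (λ a → P a ⊎ Q a)
AtLeast-⊎ P#Q (L , u , ps , k≤) (M , v , qs , l≤) =
  L ++ M , Unique.++⁺ u v (λ (x , y) → P#Q _ (All.lookup ps x) (All.lookup qs y)) ,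
  All.++⁺ (All.map inj₁ ps) (All.map inj₂ qs) ,
  subst (_ ≤_) (sym (length-++ L)) (ℕ.+-mono-≤ k≤ l≤)

AtLeast-map : ∀ {A : Set} {B : Set} {k} {P : A → Set} {Q : B → Set} (f : A → B) →
  (∀ {a b} → P a → P b → f a ≡ f b → a ≡ b) → (∀ a → P a → Q (f a)) → AtLeast k P → AtLeast k Q
AtLeast-map {P = P} f inj P⊆Q (L , u , ps , k≤) =
  map f L , map-unique u ps , All.map⁺ (All.map (P⊆Q _) ps) , subst (_ ≤_) (sym (length-map f L)) k≤
  where
  map-unique : ∀ {xs} → Unique xs → All P xs → Unique (map f xs)
  map-unique []       []       = []
  map-unique (x∉ ∷ u) (p ∷ ps) =
    All.map⁺ (All.map (λ (x≢y , py) → x≢y ∘ inj p py) (All.zip (x∉ , ps))) ∷ map-unique u ps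

AtLeast-bind : ∀ {A : Set} {B : Set} {k l} {P : A → Set} {Q : A → B → Set} →
  (∀ {a a′} → P a → P a′ → a ≢ a′ → ∀ b → Q a b → Q a′ b → ⊥) →
  AtLeast k P → (∀ a → P a → AtLeast l (Q a)) → AtLeast (k * l) (λ b → ∃ λ a → P a × Q a b)
AtLeast-bind {B = B} {k} {l} {P} {Q} disj (L , u , ps , k≤) f =
  AtLeast-mono (ℕ.*-monoˡ-≤ l k≤) (λ b (a , _ , pa , q) → a , pa , q) (go u ps)
  where
  go : ∀ {xs} → Unique xs → All P xs → AtLeast (length xs * l) (λ b → ∃ λ a → a ∈ xs × P a × Q a b)
  go []       []       = [] , [] , [] , z≤n
  go {x ∷ xs} (x∉ ∷ u) (p ∷ ps) =
    AtLeast-mono ℕ.≤-refl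
      (λ { b (inj₁ q) → x , here refl , p , q ; b (inj₂ (a , a∈ , pa , q)) → a , there a∈ , pa , q })
      (AtLeast-⊎ (λ { b q (a , a∈ , pa , q′) → disj p pa (All.lookup x∉ a∈) b q q′ }) (f x p) (go u ps))

AtLeast-remove : ∀ {A : Set} {k} {P : A → Set} → DecidableEquality A → ∀ a →
  AtLeast (suc k) P → AtLeast k (λ b → P b × b ≢ a)
AtLeast-remove {k = k} {P} _≟_ a (L , u , ps , k<) with a ∈? L
  where open import Data.List.Membership.DecPropositional _≟_ using (_∈?_)
... | no a∉L = L , u , All.tabulate (λ b∈ → All.lookup ps b∈ , λ { refl → a∉L b∈ }) , ℕ.<⇒≤ k<
... | yes a∈L with L′ , σ ← extract a∈L with Unique-resp-↭ σ u | All-resp-↭ σ ps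
...   | a∉ ∷ u′ | _ ∷ ps′ =
  L′ , u′ , All.zip (ps′ , All.map ≢-sym a∉) , s≤s⁻¹ (subst (_ ≤_) (↭-length σ) k<)

-- Transpositions of words

allVecs : ∀ n k → List (Vec (Fin n) k)
allVecs n zero    = [] ∷ []
allVecs n (suc k) = cartesianProductWith _∷_ (allFin n) (allVecs n k)

∈-allVecs : ∀ {n k} (v : Vec (Fin n) k) → v ∈ allVecs n k
∈-allVecs []      = here refl
∈-allVecs (a ∷ v) = ∈-cartesianProductWith⁺ _∷_ (∈-allFin a) (∈-allVecs v)

-- Exhaustive search over finitely many vectors; it makes the later case distinctions on a colouring
-- constructive.
anyVec? : ∀ {n k} {P : Vec (Fin n) k → Set} → Decidable P → Dec (∃ P)
anyVec? P? = map′ (λ p → let x , _ , px = find p in x , px) (λ (x , px) → lose (∈-allVecs x) px)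
  (Any.any? P? (allVecs _ _))

_≟ʷ_ : ∀ {n} → DecidableEquality (Word n)
_≟ʷ_ = Vec.≡-dec Fin._≟_

lookup-ext : ∀ {A : Set} {n} {x y : Vec A n} → (∀ p → lookup x p ≡ lookup y p) → x ≡ y
lookup-ext {x = x} {y} eq =
  trans (sym (Vec.tabulate∘lookup x)) (trans (Vec.tabulate-cong eq) (Vec.tabulate∘lookup y))

lookup-swapʳ : ∀ {n} (i j : Fin n) x → lookup (swap i j x) j ≡ lookup x i
lookup-swapʳ i j x = Vec.lookup∘update j (x [ i ]≔ lookup x j) (lookup x i)

lookup-swap-≢ : ∀ {n} (i j : Fin n) x {p} → p ≢ i → p ≢ j → lookup (swap i j x) p ≡ lookup x p
lookup-swap-≢ i j x p≢i p≢j =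
  trans (Vec.lookup∘update′ p≢j (x [ i ]≔ lookup x j) _) (Vec.lookup∘update′ p≢i x _)

lookup-swapˡ : ∀ {n} (i j : Fin n) x → lookup (swap i j x) i ≡ lookup x j
lookup-swapˡ i j x with i Fin.≟ j
... | yes refl = lookup-swapʳ i i x
... | no i≢j   = trans (Vec.lookup∘update′ i≢j (x [ i ]≔ lookup x j) _) (Vec.lookup∘update i x _)

lookup-swap : ∀ {n} (i j : Fin n) x p → lookup (swap i j x) p ≡ lookup x (transpose i j p)
lookup-swap i j x p with p Fin.≟ i
... | yes refl = lookup-swapˡ i j x
... | no p≢i with p Fin.≟ j
...   | yes refl = lookup-swapʳ i j x
...   | no p≢j   = lookup-swap-≢ i j x p≢i p≢j

swap-perm : ∀ {n} (i j : Fin n) x → IsPerm x → IsPerm (swap i j x)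
swap-perm i j x px p q eq = trans (sym (transpose-inverse j i)) (trans (cong (transpose j i)
  (px _ _ (trans (sym (lookup-swap i j x p)) (trans eq (lookup-swap i j x q))))) (transpose-inverse j i))

swap-involutive : ∀ {n} (i j : Fin n) x → swap i j (swap i j x) ≡ x
swap-involutive i j x = lookup-ext go
  where
  go : ∀ p → lookup (swap i j (swap i j x)) p ≡ lookup x p
  go p with p Fin.≟ i | p Fin.≟ j
  ... | yes refl | _        = trans (lookup-swapˡ i j (swap i j x)) (lookup-swapʳ i j x)
  ... | no _     | yes refl = trans (lookup-swapʳ i j (swap i j x)) (lookup-swapˡ i j x)
  ... | no p≢i   | no p≢j   =
    trans (lookup-swap-≢ i j (swap i j x) p≢i p≢j) (lookup-swap-≢ i j x p≢i p≢j)

AllowedSwap⇒< : ∀ {n} {i j : Fin n} → AllowedSwap i j → toℕ i < toℕ j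
AllowedSwap⇒< (inj₁ eq)       = ℕ.≤-reflexive (sym eq)
AllowedSwap⇒< (inj₂ (eq , l)) = subst (_< _) (sym eq) l

AllowedSwap⇒≢ : ∀ {n} {i j : Fin n} → AllowedSwap i j → i ≢ j
AllowedSwap⇒≢ a refl = ℕ.n≮n _ (AllowedSwap⇒< a)

swap-≢ : ∀ {n} {i j : Fin n} x → IsPerm x → i ≢ j → x ≢ swap i j x
swap-≢ {i = i} {j} x px i≢j eq = i≢j (px _ _ (trans (cong (λ y → lookup y i) eq) (lookup-swapˡ i j x)))

-- Adjacency in the subgraph generated by the allowed transpositions of positions 0, …, m - 1; its
-- components are the copies of BSₘ in BSₙ.
Nb : ∀ {n} → ℕ → Word n → Word n → Set
Nb {n} m x y = Σ (Fin n) λ i → Σ (Fin n) λ j → AllowedSwap i j × toℕ j < m × y ≡ swap i j x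

Nb-sym : ∀ {n m} {x y : Word n} → Nb m x y → Nb m y x
Nb-sym {x = x} (i , j , a , j<m , refl) = i , j , a , j<m , sym (swap-involutive i j x)

Nb-up : ∀ {n m} {x y : Word n} → Nb m x y → Nb (suc m) x y
Nb-up (i , j , a , j<m , eq) = i , j , a , ℕ.m<n⇒m<1+n j<m , eq

Nb-≢ : ∀ {n m} {x y : Word n} → IsPerm x → Nb m x y → x ≢ y
Nb-≢ {x = x} px (i , j , a , _ , refl) = swap-≢ x px (AllowedSwap⇒≢ a)

Nb⇒Adj : ∀ {n m} {x y : Word n} → IsPerm x → Nb m x y → Adj x y
Nb⇒Adj px nb@(i , j , a , _ , eq) = Nb-≢ px nb , i , j , a , eq

Adj⇒Nb : ∀ {n} {x y : Word n} → Adj x y → Nb n x y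
Adj⇒Nb (_ , i , j , a , eq) = i , j , a , Fin.toℕ<n j , eq

Adj-perm : ∀ {n} {x y : Word n} → IsPerm x → Adj x y → IsPerm y
Adj-perm {x = x} px (_ , i , j , _ , refl) = swap-perm i j x px

Adj-sym : ∀ {n} {x y : Word n} → Adj x y → Adj y x
Adj-sym (x≢y , i , j , a , eq) = ≢-sym x≢y , i , j , a , trans (sym (swap-involutive i j _)) (cong (swap i j) (sym eq))

-- y lies in the component of x in that subgraph.
record Comp {n} (m : ℕ) (x y : Word n) : Set where
  constructor comp
  field
    perm  : IsPerm y
    agree : ∀ p → m ≤ toℕ p → lookup y p ≡ lookup x p
open Comp

Comp-refl : ∀ {n m} {x : Word n} → IsPerm x → Comp m x x
Comp-refl px = comp px λ _ _ → refl

Comp-trans : ∀ {n m} {x y z : Word n} → Comp m x y → Comp m y z → Comp m x z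
Comp-trans c d = comp (perm d) λ p m≤p → trans (agree d p m≤p) (agree c p m≤p)

Comp-sym : ∀ {n m} {x y : Word n} → IsPerm x → Comp m x y → Comp m y x
Comp-sym px c = comp px λ p m≤p → sym (agree c p m≤p)

Comp-up : ∀ {n m} {x y : Word n} → Comp m x y → Comp (suc m) x y
Comp-up c = comp (perm c) λ p m<p → agree c p (ℕ.<⇒≤ m<p)

Comp-down : ∀ {n m} {x y : Word n} (t : Fin n) → toℕ t ≡ m → Comp (suc m) x y →
  lookup y t ≡ lookup x t → Comp m x y
Comp-down {m = m} {x} {y} t t≡m c et = comp (perm c) λ p m≤p → go p (ℕ.m≤n⇒m<n∨m≡n m≤p)
  where
  go : ∀ p → m < toℕ p ⊎ m ≡ toℕ p → lookup y p ≡ lookup x p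
  go p (inj₁ m<p) = agree c p m<p
  go p (inj₂ m≡p) with refl ← Fin.toℕ-injective (trans t≡m m≡p) = et

Comp-swap : ∀ {n m} {x y : Word n} {i j} → toℕ i < m → toℕ j < m → Comp m x y → Comp m x (swap i j y)
Comp-swap {x = x} {y} {i} {j} i<m j<m c = comp (swap-perm i j y (perm c)) λ p m≤p →
  trans (lookup-swap-≢ i j y (λ { refl → ℕ.<⇒≱ i<m m≤p }) (λ { refl → ℕ.<⇒≱ j<m m≤p })) (agree c p m≤p)

Comp-Nb : ∀ {n m} {x y z : Word n} → Comp m x y → Nb m y z → Comp m x z
Comp-Nb c (i , j , a , j<m , refl) = Comp-swap (ℕ.<-trans (AllowedSwap⇒< a) j<m) j<m c

IsPerm? : ∀ {n} → Decidable (IsPerm {n})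
IsPerm? x = Fin.all? λ i → Fin.all? λ j → (lookup x i Fin.≟ lookup x j) →-dec (i Fin.≟ j)

Comp? : ∀ {n} m (x : Word n) → Decidable (Comp m x)
Comp? m x y = map′ (λ (p , e) → comp p e) (λ c → perm c , agree c)
  (IsPerm? y ×-dec Fin.all? λ p → (m ℕ.≤? toℕ p) →-dec (lookup y p Fin.≟ lookup x p))

Adj? : ∀ {n} (x y : Word n) → Dec (Adj x y)
Adj? x y = ¬? (x ≟ʷ y) ×-dec Fin.any? λ i → Fin.any? λ j →
  ((toℕ j ℕ.≟ suc (toℕ i)) ⊎-dec ((toℕ i ℕ.≟ 0) ×-dec (0 ℕ.<? toℕ j))) ×-dec (y ≟ʷ swap i j x)

perm-surjective : ∀ {n} (x : Word n) → IsPerm x → ∀ a → ∃ λ p → lookup x p ≡ a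
perm-surjective {suc n} x px a with Fin.any? (λ p → lookup x p Fin.≟ a)
... | yes found = found
... | no ∄ = contradiction (Fin.injective⇒≤ {f = punchOut ∘ a≢} λ {p} {q} eq →
      px p q (Fin.punchOut-injective (a≢ p) (a≢ q) eq)) ℕ.1+n≰n
  where
  a≢ : ∀ p → a ≢ lookup x p
  a≢ p eq = ∄ (p , sym eq)

-- A value that `x` holds at a position from `m` on is held there by `y` too, so by injectivity of
-- `y` it cannot also occur in `y` below `m`.
Comp-position : ∀ {n m} {x y : Word n} → IsPerm x → Comp m x y → ∀ {q} → toℕ q < m →
  ∃ λ p → toℕ p < m × lookup x p ≡ lookup y q
Comp-position {m = m} {x} {y} px c {q} q<m
  with p , eq ← perm-surjective x px (lookup y q) with toℕ p ℕ.<? m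
... | yes p<m = p , p<m , eq
... | no p≮m with refl ← perm c p q (trans (agree c p (ℕ.≮⇒≥ p≮m)) eq) = contradiction q<m p≮m

-- Edge cuts

two : ∀ {A : Set} {P : A → Set} {a b} → a ≢ b → P a → P b → AtLeast 2 P
two {a = a} {b} a≢b pa pb = a ∷ b ∷ [] , (a≢b ∷ []) ∷ [] ∷ [] , pa ∷ pb ∷ [] , ℕ.≤-refl

toℕ≢⇒≢ : ∀ {n} {i j : Fin n} → toℕ i ≢ toℕ j → i ≢ j
toℕ≢⇒≢ ne = ne ∘ cong toℕ

-- For position 1 the two kinds of transposition coincide, so `neighbours` starts with a single
-- swap; each later position adds two, whence the degree `1 + 2 * k` on `2 + k` positions. The list
-- `extra` on its own serves as the set of lost neighbours in the sharpness example.
extra : ∀ {n} k → 2 + k ≤ 2 + n → Word (2 + n) → List (Word (2 + n))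
extra zero    _  x = []
extra (suc k) le x = swap zero t x ∷ swap q t x ∷ extra k (ℕ.<⇒≤ le) x
  where
  t = fromℕ< le
  q = fromℕ< (ℕ.<⇒≤ le)

neighbours : ∀ {n} k → 2 + k ≤ 2 + n → Word (2 + n) → List (Word (2 + n))
neighbours k le x = swap zero (suc zero) x ∷ extra k le x

length-extra : ∀ {n} k (le : 2 + k ≤ 2 + n) x → length (extra k le x) ≡ 2 * k
length-extra zero    le x = refl
length-extra (suc k) le x = trans (cong (2 +_) (length-extra k _ x)) (sym (ℕ.*-suc 2 k))

∈-neighbours⁻ : ∀ {n} k (le : 2 + k ≤ 2 + n) {x y} → y ∈ neighbours k le x → Nb (2 + k) x y
∈-neighbours⁻ k       le (here eq)           = zero , suc zero , inj₁ refl , s≤s (s≤s z≤n) , eq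
∈-neighbours⁻ (suc k) le (there (here eq))   =
  zero , _ , inj₂ (refl , subst (0 <_) (sym (Fin.toℕ-fromℕ< le)) (s≤s z≤n)) ,
  ℕ.≤-reflexive (cong suc (Fin.toℕ-fromℕ< le)) , eq
∈-neighbours⁻ (suc k) le (there (there (here eq))) =
  _ , _ , inj₁ (trans (Fin.toℕ-fromℕ< le) (cong suc (sym (Fin.toℕ-fromℕ< (ℕ.<⇒≤ le))))) ,
  ℕ.≤-reflexive (cong suc (Fin.toℕ-fromℕ< le)) , eq
∈-neighbours⁻ (suc k) le (there (there (there p))) = Nb-up (∈-neighbours⁻ k (ℕ.<⇒≤ le) (there p))

∈-neighbours⁺ : ∀ {n} k (le : 2 + k ≤ 2 + n) {x y} → Nb (2 + k) x y → y ∈ neighbours k le x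
∈-neighbours⁺ zero le {x} (i , j , inj₁ a , j<2 , eq) = here (trans eq (cong₂ (λ i j → swap i j x) i≡0 j≡1))
  where
  i≡0 : i ≡ zero
  i≡0 = Fin.toℕ-injective (ℕ.n<1⇒n≡0 (s≤s⁻¹ (subst (_< 2) a j<2)))
  j≡1 : j ≡ suc zero
  j≡1 = Fin.toℕ-injective (trans a (cong (suc ∘ toℕ) i≡0))
∈-neighbours⁺ zero le {x} (i , j , inj₂ (i≡0 , 0<j) , j<2 , eq) =
  here (trans eq (cong₂ (λ i j → swap i j x) (Fin.toℕ-injective i≡0) (Fin.toℕ-injective (ℕ.≤-antisym (s≤s⁻¹ j<2) 0<j))))
∈-neighbours⁺ (suc k) le {x} (i , j , a , j<m , eq) with ℕ.m≤n⇒m<n∨m≡n (s≤s⁻¹ j<m)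
... | inj₁ j< with ∈-neighbours⁺ k (ℕ.<⇒≤ le) (i , j , a , j< , eq)
...   | here eq′ = here eq′
...   | there p  = there (there (there p))
∈-neighbours⁺ (suc k) le {x} (i , j , inj₁ a , j<m , eq) | inj₂ j≡ =
  there (there (here (trans eq (cong₂ (λ i j → swap i j x)
    (Fin.toℕ-injective (trans (ℕ.suc-injective (trans (sym a) j≡)) (sym (Fin.toℕ-fromℕ< (ℕ.<⇒≤ le)))))
    (Fin.toℕ-injective (trans j≡ (sym (Fin.toℕ-fromℕ< le))))))))
∈-neighbours⁺ (suc k) le {x} (i , j , inj₂ (i≡0 , _) , j<m , eq) | inj₂ j≡ =
  there (here (trans eq (cong₂ (λ i j → swap i j x) (Fin.toℕ-injective i≡0)
    (Fin.toℕ-injective (trans j≡ (sym (Fin.toℕ-fromℕ< le)))))))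

-- Moves among the positions below `m` fix the entry at `t`, while the swap with `t` changes it.
swap-top-≢ : ∀ {n m} {i t : Fin n} {x y : Word n} → IsPerm x → i ≢ t → m ≤ toℕ t → Nb m x y → swap i t x ≢ y
swap-top-≢ {i = i} {t} {x} px i≢t m≤t nb eq = i≢t (px i t (trans (sym (lookup-swapʳ i t x))
  (trans (cong (λ w → lookup w t) eq) (agree (Comp-Nb (Comp-refl px) nb) t m≤t))))

swap-≢-swap : ∀ {n} {i j t : Fin n} x → IsPerm x → i ≢ j → i ≢ t → swap i t x ≢ swap j t x
swap-≢-swap {i = i} {j} {t} x px i≢j i≢t eq = i≢t (px i t (trans (sym (lookup-swap-≢ j t x i≢j i≢t))
  (trans (cong (λ w → lookup w i) (sym eq)) (lookup-swapˡ i t x))))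

neighbours-unique : ∀ {n} k (le : 2 + k ≤ 2 + n) {x} → IsPerm x → Unique (neighbours k le x)
neighbours-unique zero    le     px = [] ∷ []
neighbours-unique (suc k) le {x} px with neighbours-unique k (ℕ.<⇒≤ le) px
... | x∉ ∷ u =
  (≢-sym (All.lookup 0t∉ (here refl)) ∷ ≢-sym (All.lookup qt∉ (here refl)) ∷ x∉) ∷
  (swap-≢-swap x px 0≢q 0≢t ∷ All.tail 0t∉) ∷ All.tail qt∉ ∷ u
  where
  t = fromℕ< le
  q = fromℕ< (ℕ.<⇒≤ le)
  t≡ : toℕ t ≡ 2 + k
  t≡ = Fin.toℕ-fromℕ< le
  q≡ : toℕ q ≡ 1 + k
  q≡ = Fin.toℕ-fromℕ< (ℕ.<⇒≤ le)
  0≢q : zero ≢ q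
  0≢q = toℕ≢⇒≢ λ eq → ℕ.0≢1+n (trans eq q≡)
  0≢t : zero ≢ t
  0≢t = toℕ≢⇒≢ λ eq → ℕ.0≢1+n (trans eq t≡)
  q≢t : q ≢ t
  q≢t = toℕ≢⇒≢ λ eq → ℕ.m≢1+m+n k (ℕ.suc-injective (trans (sym q≡) (trans eq (trans t≡ (cong (2 +_) (sym (ℕ.+-identityʳ k)))))))
  fresh : ∀ {i} → i ≢ t → All (swap i t x ≢_) (neighbours k (ℕ.<⇒≤ le) x)
  fresh i≢t = All.tabulate λ y∈ → swap-top-≢ px i≢t (ℕ.≤-reflexive (sym t≡)) (∈-neighbours⁻ k _ y∈)
  0t∉ = fresh 0≢t
  qt∉ = fresh q≢t

AtLeast-Nb : ∀ {n} k → 2 + k ≤ 2 + n → (x : Word (2 + n)) → IsPerm x → AtLeast (1 + 2 * k) (Nb (2 + k) x)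
AtLeast-Nb k le x px = neighbours k le x , neighbours-unique k le px ,
  All.tabulate (∈-neighbours⁻ k le) , ℕ.≤-reflexive (cong suc (sym (length-extra k le x)))

-- Cuts as two-colourings, and the induction step of the cut bound

Colouring : ℕ → Set
Colouring n = Word n → Bool

-- The orientation from `true` to `false` lets each undirected cut edge occur as exactly one pair,
-- so counting distinct pairs counts edges.
record Cut {n} (m : ℕ) (x₀ : Word n) (χ : Colouring n) (e : Edge n) : Set where
  constructor cut
  field
    source  : Comp m x₀ (proj₁ e)
    nb      : Nb m (proj₁ e) (proj₂ e)
    inside  : χ (proj₁ e) ≡ true
    outside : χ (proj₂ e) ≡ false
open Cut

In : ∀ {n} → ℕ → Word n → Colouring n → Bool → Word n → Set
In m x₀ χ b x = Comp m x₀ x × χ x ≡ b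

In? : ∀ {n} m (x₀ : Word n) χ b x → Dec (In m x₀ χ b x)
In? m x₀ χ b x = Comp? m x₀ x ×-dec (χ x Bool.≟ b)

Two : ∀ {A : Set} → (A → Set) → Set
Two P = ∃ λ a → ∃ λ b → a ≢ b × P a × P b

-- Reversing every arc matches the cuts of the two colourings; arguments about one colour thereby
-- serve for the other.
flip-cut : ∀ {n m k} {x₀ : Word n} {χ} → AtLeast k (Cut m x₀ (not ∘ χ)) → AtLeast k (Cut m x₀ χ)
flip-cut = AtLeast-map Product.swap (λ { _ _ refl → refl }) λ (x , y) c →
  cut (Comp-Nb (source c) (nb c)) (Nb-sym (nb c))
    (Bool.not-injective (outside c)) (Bool.not-injective (inside c))

In-not : ∀ {n m} {x₀ : Word n} {χ b x} → In m x₀ χ b x → In m x₀ (not ∘ χ) (not b) x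
In-not (c , eq) = c , cong not eq

isolated-cut : ∀ {n m k} {x₀ : Word n} {χ s} → In m x₀ χ true s →
  (∀ y → y ≢ s → Comp m x₀ y → χ y ≡ false) → AtLeast k (Nb m s) → AtLeast k (Cut m x₀ χ)
isolated-cut {s = s} (c , i) out = AtLeast-map (s ,_) (λ _ _ → ,-injectiveʳ)
  λ y nb → cut c nb i (out y (≢-sym (Nb-≢ (perm c) nb)) (Comp-Nb c nb))

-- The bound 4 m - 8 for m = 3 + k; likewise 3 + 2 * k below is the degree 2 m - 3.
Bound : ℕ → ℕ → Set
Bound n k = ∀ (x₀ : Word n) χ → IsPerm x₀ → Two (In (3 + k) x₀ χ true) → Two (In (3 + k) x₀ χ false) →
  AtLeast (4 + 4 * k) (Cut (3 + k) x₀ χ)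

-- Edge connectivity equals degree: a side with a single vertex is cut off by all its edges, and
-- otherwise `Bound` gives even more.
nonempty-cut : ∀ {n} k → 3 + k ≤ 3 + n → Bound (3 + n) k → ∀ x₀ χ → IsPerm x₀ →
  ∃ (In (3 + k) x₀ χ true) → ∃ (In (3 + k) x₀ χ false) → AtLeast (3 + 2 * k) (Cut (3 + k) x₀ χ)
nonempty-cut k le bound x₀ χ p₀ (s , is) (t , it)
  with anyVec? (λ y → ¬? (y ≟ʷ s) ×-dec In? (3 + k) x₀ χ true y)
     | anyVec? (λ y → ¬? (y ≟ʷ t) ×-dec In? (3 + k) x₀ χ false y)
... | yes (s′ , ne , is′) | yes (t′ , ne′ , it′) =
  AtLeast-mono (ℕ.+-mono-≤ (ℕ.n≤1+n 3) (ℕ.*-monoˡ-≤ k (ℕ.m≤m+n 2 2))) (λ _ c → c)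
    (bound x₀ χ p₀ (s′ , s , ne , is′ , is) (t′ , t , ne′ , it′ , it))
... | no ∄s′ | _ = AtLeast-mono (ℕ.≤-reflexive (cong suc (sym (ℕ.*-suc 2 k)))) (λ _ c → c)
  (isolated-cut is (λ y ne c → Bool.¬-not λ i → ∄s′ (y , ne , c , i)) (AtLeast-Nb (1 + k) le s (perm (proj₁ is))))
... | _ | no ∄t′ = AtLeast-mono (ℕ.≤-reflexive (cong suc (sym (ℕ.*-suc 2 k)))) (λ _ c → c)
  (flip-cut (isolated-cut (In-not {χ = χ} it) (λ y ne c → cong not (Bool.¬-not λ i → ∄t′ (y , ne , c , i)))
    (AtLeast-Nb (1 + k) le t (perm (proj₁ it)))))

3m-bound : ∀ k → 8 + 4 * k ≤ (3 + 2 * k) + ((3 + 2 * k) + (3 + 2 * k))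
3m-bound k = subst (8 + 4 * k ≤_) (eq k) (ℕ.m≤m+n _ _)
  where
  eq : ∀ k → (8 + 4 * k) + (1 + 2 * k) ≡ (3 + 2 * k) + ((3 + 2 * k) + (3 + 2 * k))
  eq = solve-∀

-- One step of the induction: the component of x₀ for positions 0, …, t is the disjoint union
-- of copies, indexed by the label found at position t, of the components for positions below t.
module Step {n} (k : ℕ) (le : 4 + k ≤ 3 + n) (bound : Bound (3 + n) k) where

  m : ℕ
  m = 3 + k

  t q : Fin (3 + n)
  t = fromℕ< le
  q = fromℕ< (ℕ.<⇒≤ le)

  t≡m : toℕ t ≡ m
  t≡m = Fin.toℕ-fromℕ< le

  q≡ : toℕ q ≡ 2 + k
  q≡ = Fin.toℕ-fromℕ< (ℕ.<⇒≤ le)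

  q<m : toℕ q < m
  q<m = ℕ.≤-reflexive (cong suc q≡)

  <m⇒≢t : ∀ {p} → toℕ p < m → p ≢ t
  <m⇒≢t p<m refl = ℕ.<-irrefl t≡m p<m

  0≢q : zero ≢ q
  0≢q = toℕ≢⇒≢ λ eq → ℕ.0≢1+n (trans eq q≡)

  label : Word (3 + n) → Fin (3 + n)
  label x = lookup x t

  label-Comp : ∀ {x y} → Comp m x y → label y ≡ label x
  label-Comp c = agree c t (ℕ.≤-reflexive (sym t≡m))

  0t-Nb : ∀ x → Nb (suc m) x (swap zero t x)
  0t-Nb x = zero , t , inj₂ (refl , subst (0 <_) (sym t≡m) (s≤s z≤n)) , ℕ.≤-reflexive (cong suc t≡m) , refl

  qt-Nb : ∀ x → Nb (suc m) x (swap q t x)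
  qt-Nb x = q , t , inj₁ (trans t≡m (cong suc (sym q≡))) , ℕ.≤-reflexive (cong suc t≡m) , refl

  Exit : Word (3 + n) → Edge (3 + n) → Set
  Exit s (x , y) = x ≡ s × Nb (suc m) x y × label y ≢ label x

  label-swap-≢ : ∀ {p} x → IsPerm x → p ≢ t → label (swap p t x) ≢ label x
  label-swap-≢ x px p≢t eq = p≢t (px _ _ (trans (sym (lookup-swapʳ _ t x)) eq))

  two-exits : ∀ s → IsPerm s → AtLeast 2 (Exit s)
  two-exits s ps =
    two (swap-≢-swap s ps 0≢q (<m⇒≢t (s≤s z≤n)) ∘ ,-injectiveʳ)
      (refl , 0t-Nb s , label-swap-≢ s ps (<m⇒≢t (s≤s z≤n)))
      (refl , qt-Nb s , label-swap-≢ s ps (<m⇒≢t q<m))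

  -- The entries of `s` at positions 0 and `q` are different, and they become the labels of the two
  -- outside neighbours; at most one of them is `b`.
  exit-avoiding : ∀ s b → IsPerm s → AtLeast 1 (λ e → Exit s e × label (proj₂ e) ≢ b)
  exit-avoiding s b ps with lookup s zero Fin.≟ b
  ... | no ≢b = one _ ((refl , 0t-Nb s , label-swap-≢ s ps (<m⇒≢t (s≤s z≤n))) ,
                       λ eq → ≢b (trans (sym (lookup-swapʳ zero t s)) eq))
  ... | yes ≡b = one _ ((refl , qt-Nb s , label-swap-≢ s ps (<m⇒≢t q<m)) ,
                        λ eq → 0≢q (ps _ _ (trans ≡b (trans (sym eq) (lookup-swapʳ q t s)))))

  Crossing : Word (3 + n) → Fin (3 + n) → Edge (3 + n) → Set
  Crossing x b (y , z) = Comp m x y × Nb (suc m) y z × label z ≡ b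

  -- A word of the copy of `x` crosses to the label of `z` when that label sits at position 0 or at
  -- `q`. Each of the two places is realised by two words, which differ by a swap of two other
  -- positions below `m`; such positions exist because `m` is at least 3.
  crossings : ∀ {x₀ x z} → IsPerm x₀ → Comp (suc m) x₀ x → Comp (suc m) x₀ z → label z ≢ label x →
    AtLeast 4 (Crossing x (label z))
  crossings {x₀} {x} {z} p₀ cx cz lz≢ =
    AtLeast-mono ℕ.≤-refl (λ { e (inj₁ (c , _)) → c ; e (inj₂ (c , _)) → c })
      (AtLeast-⊎ (λ { e ((c , _) , l) (_ , r) → 0≢q (perm c _ _ (trans l (sym r))) })
        (via zero (s≤s z≤n) 0t-Nb (suc zero) (suc (suc zero)) (s≤s (s≤s z≤n)) (s≤s (s≤s (s≤s z≤n)))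
          (λ ()) (λ ()) (λ ()))
        (via q q<m qt-Nb zero (suc zero) (s≤s z≤n) (s≤s (s≤s z≤n))
          (≢-sym 0≢q) (toℕ≢⇒≢ λ eq → ℕ.1+n≢0 (ℕ.suc-injective (trans (sym q≡) eq))) (λ ())))
    where
    position : ∃ λ p → toℕ p < suc m × lookup x p ≡ label z
    position = Comp-position (perm cx) (Comp-trans (Comp-sym p₀ cx) cz) (ℕ.≤-reflexive (cong suc t≡m))
    p : Fin (3 + n)
    p = proj₁ position
    p<m : toℕ p < m
    p<m = ℕ.≤∧≢⇒< (s≤s⁻¹ (proj₁ (proj₂ position)))
      λ eq → lz≢ (trans (sym (proj₂ (proj₂ position))) (cong (lookup x) (Fin.toℕ-injective (trans eq (sym t≡m)))))
    via : ∀ r → toℕ r < m → (∀ y → Nb (suc m) y (swap r t y)) →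
      ∀ i j → toℕ i < m → toℕ j < m → r ≢ i → r ≢ j → i ≢ j →
      AtLeast 2 (λ e → Crossing x (label z) e × lookup (proj₁ e) r ≡ label z)
    via r r<m rt-Nb i j i<m j<m r≢i r≢j i≢j =
      AtLeast-map {P = λ y → Comp m x y × lookup y r ≡ label z} (λ y → y , swap r t y) (λ _ _ → ,-injectiveˡ)
        (λ y (c , eq) → (c , rt-Nb y , trans (lookup-swapʳ r t y) eq) , eq)
        (two (swap-≢ y₁ (perm c₁) i≢j) (c₁ , eq₁)
          (Comp-swap i<m j<m c₁ , trans (lookup-swap-≢ i j y₁ r≢i r≢j) eq₁))
      where
      y₁ = swap r p x
      c₁ : Comp m x y₁
      c₁ = Comp-swap r<m p<m (Comp-refl (perm cx))
      eq₁ : lookup y₁ r ≡ label z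
      eq₁ = trans (lookup-swapˡ r p x) (proj₂ (proj₂ position))

  module _ (x₀ : Word (3 + n)) (p₀ : IsPerm x₀) where

    -- Any of the first `m + 1` entries of `x₀` can be brought to position `t` by one swap.
    labels : AtLeast (4 + k) (λ a → ∃ λ x → Comp (suc m) x₀ x × label x ≡ a)
    labels = AtLeast-map (lookup x₀) (λ _ _ → p₀ _ _)
      (λ p p<m → swap p t x₀ , Comp-swap p<m (ℕ.≤-reflexive (cong suc t≡m)) (Comp-refl p₀) , lookup-swapʳ p t x₀)
      ( tabulate (λ i → inject≤ i le)
      , Unique.tabulate⁺ (Fin.inject≤-injective le le _ _)
      , All.tabulate⁺ (λ i → subst (_< 4 + k) (sym (Fin.toℕ-inject≤ i le)) (Fin.toℕ<n i))
      , ℕ.≤-reflexive (sym (length-tabulate (λ i → inject≤ i le))))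

    module _ (χ : Colouring (3 + n)) where

      inner : ∀ {x} → Comp (suc m) x₀ x → ∃ (In m x χ true) → ∃ (In m x χ false) →
        AtLeast (3 + 2 * k) (Cut m x χ)
      inner cx = nonempty-cut k (ℕ.<⇒≤ le) bound _ χ (perm cx)

      inner⊆ : ∀ {x e} → Comp (suc m) x₀ x → Cut m x χ e → Cut (suc m) x₀ χ e
      inner⊆ cx c = cut (Comp-trans cx (Comp-up (source c))) (Nb-up (nb c)) (inside c) (outside c)

      inner-labelˡ : ∀ {x e} → Cut m x χ e → label (proj₁ e) ≡ label x
      inner-labelˡ c = label-Comp (source c)

      inner-labelʳ : ∀ {x e} → Cut m x χ e → label (proj₂ e) ≡ label x
      inner-labelʳ c = label-Comp (Comp-Nb (source c) (nb c))

      inner-exit : ∀ {x s e} → Cut m x χ e → Exit s e → ⊥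
      inner-exit c (_ , _ , ne) = ne (trans (inner-labelʳ c) (sym (inner-labelˡ c)))

      mixed : (∀ x → Comp (suc m) x₀ x → ∃ (In m x χ false)) → ∀ {x} → In (suc m) x₀ χ true x →
        AtLeast (3 + 2 * k) (Cut m x χ)
      mixed out (c , i) = inner c (_ , Comp-refl (perm c) , i) (out _ c)

      -- If three copies meet the coloured side, the cuts inside them suffice. If it meets only one or
      -- two, edges leaving these copies are cut as well.
      no-full-copy : (∀ x → Comp (suc m) x₀ x → ∃ (In m x χ false)) → Two (In (suc m) x₀ χ true) →
        AtLeast (8 + 4 * k) (Cut (suc m) x₀ χ)
      no-full-copy out (s , s₂ , s≢s₂ , is@(cs , s∈) , (cs₂ , s₂∈))
        with anyVec? (λ y → ¬? (label y Fin.≟ label s) ×-dec In? (suc m) x₀ χ true y)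
      no-full-copy out (s , s₂ , s≢s₂ , is@(cs , s∈) , (cs₂ , s₂∈)) | yes (r , r≢s , ir@(cr , r∈))
        with anyVec? (λ y → ¬? (label y Fin.≟ label s) ×-dec ¬? (label y Fin.≟ label r) ×-dec In? (suc m) x₀ χ true y)
      ... | yes (u , u≢s , u≢r , iu@(cu , u∈)) =
        AtLeast-mono (3m-bound k)
          (λ { e (inj₁ c) → inner⊆ cs c ; e (inj₂ (inj₁ c)) → inner⊆ cr c ; e (inj₂ (inj₂ c)) → inner⊆ cu c })
          (AtLeast-⊎ (λ { e c (inj₁ d) → apart (≢-sym r≢s) c d ; e c (inj₂ d) → apart (≢-sym u≢s) c d }) (mixed out is)
            (AtLeast-⊎ (λ e c d → apart (≢-sym u≢r) c d) (mixed out ir) (mixed out iu)))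
        where
        apart : ∀ {x y e} → label x ≢ label y → Cut m x χ e → Cut m y χ e → ⊥
        apart ne c d = ne (trans (sym (inner-labelˡ c)) (inner-labelˡ d))
      ... | no ∄u =
        -- The two inner cuts fall short by two edges. These are an exit of `s` that avoids the copy
        -- of `r` and an exit of `r` that avoids the copy of `s`; both end in copies that are
        -- entirely `false`.
        AtLeast-mono (ℕ.≤-reflexive (eq k))
          (λ { e (inj₁ c) → inner⊆ cs c ; e (inj₂ (inj₁ c)) → inner⊆ cr c
             ; e (inj₂ (inj₂ (inj₁ (x@(refl , _ , ≢s) , ≢r)))) → leave is x ≢s ≢r
             ; e (inj₂ (inj₂ (inj₂ (x@(refl , _ , ≢r) , ≢s)))) → leave ir x ≢s ≢r })
          (AtLeast-⊎ (λ { e c (inj₁ d) → r≢s (trans (sym (inner-labelˡ d)) (inner-labelˡ c))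
                        ; e c (inj₂ (inj₁ (x , _))) → inner-exit c x ; e c (inj₂ (inj₂ (x , _))) → inner-exit c x })
            (mixed out is)
            (AtLeast-⊎ (λ { e c (inj₁ (x , _)) → inner-exit c x ; e c (inj₂ (x , _)) → inner-exit c x })
              (mixed out ir)
              (AtLeast-⊎ (λ { e ((refl , _) , _) ((refl , _) , _) → r≢s refl })
                (exit-avoiding s (label r) (perm cs)) (exit-avoiding r (label s) (perm cr)))))
        where
        eq : ∀ k → 8 + 4 * k ≡ (3 + 2 * k) + ((3 + 2 * k) + (1 + 1))
        eq = solve-∀
        leave : ∀ {x e} → In (suc m) x₀ χ true x → Exit x e → label (proj₂ e) ≢ label s → label (proj₂ e) ≢ label r →
          Cut (suc m) x₀ χ e
        leave (c , i) (refl , b , _) ≢s ≢r =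
          cut c b i (Bool.¬-not λ i′ → ∄u (_ , ≢s , ≢r , Comp-Nb c b , i′))
      no-full-copy out (s , s₂ , s≢s₂ , is@(cs , s∈) , (cs₂ , s₂∈)) | no ∄r =
        -- All `true` words lie in the copy of `s`, so every exit from a `true` word is cut. It
        -- remains to see whether that copy has a second `false` word, as `bound` requires.
        go (anyVec? λ y → ¬? (y ≟ʷ t₁) ×-dec In? m s χ false y)
        where
        ls : ∀ {x} → In (suc m) x₀ χ true x → label x ≡ label s
        ls {x} i with label x Fin.≟ label s
        ... | yes eq = eq
        ... | no ne  = contradiction (x , ne , i) ∄r
        t₁ : Word (3 + n)
        t₁ = proj₁ (out s cs)
        it₁ : In m s χ false t₁
        it₁ = proj₂ (out s cs)
        leave : ∀ {x e} → In (suc m) x₀ χ true x → Exit x e → Cut (suc m) x₀ χ e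
        leave i@(c , i′) (refl , b , ne) =
          cut c b i′ (Bool.¬-not λ j → ne (trans (ls (Comp-Nb c b , j)) (sym (ls i))))
        is₂ : In m s χ true s₂
        is₂ = Comp-down t t≡m (Comp-trans (Comp-sym p₀ cs) cs₂) (ls (cs₂ , s₂∈)) , s₂∈
        go : Dec (∃ λ y → y ≢ t₁ × In m s χ false y) → AtLeast (8 + 4 * k) (Cut (suc m) x₀ χ)
        go (yes (t₂ , t₂≢t₁ , it₂)) =
          AtLeast-mono (ℕ.≤-reflexive (eq k))
            (λ { e (inj₁ c) → inner⊆ cs c ; e (inj₂ (inj₁ x)) → leave is x ; e (inj₂ (inj₂ x)) → leave (cs₂ , s₂∈) x })
            (AtLeast-⊎ (λ { e c (inj₁ x) → inner-exit c x ; e c (inj₂ x) → inner-exit c x })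
              (bound s χ (perm cs) (s , s₂ , s≢s₂ , (Comp-refl (perm cs) , s∈) , is₂) (t₂ , t₁ , t₂≢t₁ , it₂ , it₁))
              (AtLeast-⊎ (λ { e (refl , _) (refl , _) → s≢s₂ refl }) (two-exits s (perm cs)) (two-exits s₂ (perm cs₂))))
          where
          eq : ∀ k → 8 + 4 * k ≡ (4 + 4 * k) + (2 + 2)
          eq = solve-∀
        -- Here `t₁` is the only `false` word of its copy, so its `3 + 2 * k` neighbours there are
        -- all `true`, and each supplies two exits.
        go (no ∄t₂) =
          AtLeast-mono (subst (8 + 4 * k ≤_) (eq k) (ℕ.m≤m+n _ _))
            (λ { e (inj₁ c) → inner⊆ cs c ; e (inj₂ (x , nx , ex)) → leave (member nx) ex })
            (AtLeast-⊎ (λ { e c (x , _ , ex) → inner-exit c ex })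
              (inner cs (s , Comp-refl (perm cs) , s∈) (t₁ , it₁))
              (AtLeast-bind (λ { _ _ x≢y e (refl , _) (refl , _) → x≢y refl })
                (AtLeast-Nb (1 + k) (ℕ.<⇒≤ le) t₁ (perm (proj₁ it₁)))
                λ x nx → two-exits x (perm (Comp-Nb (proj₁ it₁) nx))))
          where
          eq : ∀ k → 8 + 4 * k + (1 + 2 * k) ≡ (3 + 2 * k) + (1 + 2 * (1 + k)) * 2
          eq = solve-∀
          member : ∀ {x} → Nb m t₁ x → In (suc m) x₀ χ true x
          member {x} nx = Comp-trans cs (Comp-up c) , Bool.¬-not λ j → ∄t₂ (x , ≢-sym (Nb-≢ (perm (proj₁ it₁)) nx) , c , j)
            where
            c : Comp m s x
            c = Comp-Nb (proj₁ it₁) nx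

      Touches : Fin (3 + n) → Edge (3 + n) → Set
      Touches a e = label (proj₁ e) ≡ a ⊎ label (proj₂ e) ≡ a

      -- With the copy of x full and that of y empty, every label a other than that of x is charged
      -- with the edges joining the copy a to one of these two, or with the cut inside the copy a.
      full-copies : ∀ {x y} → Comp (suc m) x₀ x → Comp (suc m) x₀ y →
        ¬ ∃ (In m x χ false) → ¬ ∃ (In m y χ true) → AtLeast (8 + 4 * k) (Cut (suc m) x₀ χ)
      full-copies {x} {y} cx cy full empty =
        AtLeast-mono (enough k) (λ { e (a , _ , c , _) → c })
          (AtLeast-bind disjoint (AtLeast-remove Fin._≟_ (label x) labels) charge)
        where
        -- The charge per label is the smaller of 4, the edges between two copies, and `3 + 2 * k`,
        -- the inner cut of a split copy. With `3 + k` labels it suffices even for `k` = 0, where 3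
        -- * 3 exceeds 8.
        c : ℕ → ℕ
        c zero    = 3
        c (suc _) = 4
        enough : ∀ k → 8 + 4 * k ≤ (3 + k) * c k
        enough zero    = ℕ.n≤1+n 8
        enough (suc k) = subst (8 + 4 * suc k ≤_) (eq k) (ℕ.m≤m+n _ 4)
          where
          eq : ∀ k → 8 + 4 * suc k + 4 ≡ (3 + suc k) * 4
          eq = solve-∀
        c≤4 : ∀ k → c k ≤ 4
        c≤4 zero    = ℕ.n≤1+n 3
        c≤4 (suc k) = ℕ.≤-refl
        c≤inner : ∀ k → c k ≤ 3 + 2 * k
        c≤inner zero    = ℕ.≤-refl
        c≤inner (suc k) = ℕ.+-monoʳ-≤ 3 (s≤s z≤n)

        Label : Fin (3 + n) → Set
        Label a = (∃ λ z → Comp (suc m) x₀ z × label z ≡ a) × a ≢ label x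

        Charged : Fin (3 + n) → Edge (3 + n) → Set
        Charged a e = Cut (suc m) x₀ χ e × Touches a e ×
          (∀ b → Touches b e → b ≡ label x ⊎ b ≡ label y ⊎ b ≡ a)

        -- An edge charged to two labels touches both. As neither is the label of `x`, each would
        -- have to be the label of `y`, so the two would agree.
        disjoint : ∀ {a a′} → Label a → Label a′ → a ≢ a′ → ∀ e → Charged a e → Charged a′ e → ⊥
        disjoint (_ , a≢x) (_ , a′≢x) a≢a′ e (_ , ta , oa) (_ , ta′ , oa′) with oa′ _ ta | oa _ ta′
        ... | inj₁ a≡x         | _                 = a≢x a≡x
        ... | inj₂ (inj₂ eq)   | _                 = a≢a′ eq
        ... | inj₂ (inj₁ _)    | inj₁ a′≡x         = a′≢x a′≡x
        ... | inj₂ (inj₁ _)    | inj₂ (inj₂ eq)    = a≢a′ (sym eq)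
        ... | inj₂ (inj₁ a≡y)  | inj₂ (inj₁ a′≡y)  = a≢a′ (trans a≡y (sym a′≡y))

        filled : ∀ {z w} → ¬ ∃ (In m z χ false) → Comp m z w → χ w ≡ true
        filled full c = Bool.¬-not λ i → full (_ , c , i)
        unfilled : ∀ {z w} → ¬ ∃ (In m z χ true) → Comp m z w → χ w ≡ false
        unfilled empty c = Bool.¬-not λ i → empty (_ , c , i)

        between : ∀ {z w} → Comp (suc m) x₀ z → Comp (suc m) x₀ w →
          ¬ ∃ (In m z χ false) → ¬ ∃ (In m w χ true) → ∀ {e} → Crossing z (label w) e →
          Cut (suc m) x₀ χ e × label (proj₁ e) ≡ label z × label (proj₂ e) ≡ label w
        between cz cw f g (c , b , l) =
          cut source′ b (filled f c) (unfilled g (Comp-down t t≡m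
            (Comp-trans (Comp-sym p₀ cw) (Comp-Nb source′ b)) l)) , label-Comp c , l
          where
          source′ = Comp-trans cz (Comp-up c)

        full≢empty : ∀ {z w} → Comp (suc m) x₀ z → Comp (suc m) x₀ w →
          ¬ ∃ (In m z χ false) → ¬ ∃ (In m w χ true) → label w ≢ label z
        full≢empty {z} {w} cz cw f g eq with () ←
          trans (sym (filled f (Comp-down t t≡m (Comp-trans (Comp-sym p₀ cz) cw) eq)))
                (unfilled g (Comp-refl (perm cw)))

        charge : ∀ a → Label a → AtLeast (c k) (Charged a)
        charge a ((z , cz , refl) , a≢x) with anyVec? (In? m z χ true) | anyVec? (In? m z χ false)
        ... | yes is | yes os = AtLeast-mono (c≤inner k)
              (λ e d → inner⊆ cz d , inj₁ (inner-labelˡ d) ,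
                λ { b (inj₁ l) → inj₂ (inj₂ (trans (sym l) (inner-labelˡ d)))
                  ; b (inj₂ l) → inj₂ (inj₂ (trans (sym l) (inner-labelʳ d))) })
              (inner cz is os)
        ... | no ∄i | _ = AtLeast-mono (c≤4 k)
              (λ e d → let c′ , l₁ , l₂ = between cx cz full ∄i d in c′ , inj₂ l₂ ,
                λ { b (inj₁ l) → inj₁ (trans (sym l) l₁) ; b (inj₂ l) → inj₂ (inj₂ (trans (sym l) l₂)) })
              (crossings p₀ cx cz a≢x)
        ... | yes _ | no ∄o = AtLeast-mono (c≤4 k)
              (λ e d → let c′ , l₁ , l₂ = between cz cy ∄o empty d in c′ , inj₁ l₁ ,
                λ { b (inj₁ l) → inj₂ (inj₂ (trans (sym l) l₁)) ; b (inj₂ l) → inj₂ (inj₁ (trans (sym l) l₂)) })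
              (crossings p₀ cz cy (full≢empty cz cy ∄o empty))

  -- If a full and an empty copy both exist, `full-copies` applies. Otherwise one of the colours
  -- occurs in every copy, and `no-full-copy` applies to the other colour, after an exchange of
  -- colours if necessary.
  Bound-suc : Bound (3 + n) (suc k)
  Bound-suc x₀ χ p₀ ins outs = AtLeast-mono (ℕ.≤-reflexive (cong (4 +_) (ℕ.*-suc 4 k))) (λ _ c → c) main
    where
    full? : ∀ b → Dec (∃ λ x → Comp (suc m) x₀ x × ¬ ∃ (In m x χ b))
    full? b = anyVec? λ x → Comp? (suc m) x₀ x ×-dec ¬? (anyVec? (In? m x χ b))
    inhabited : ∀ {b} → ¬ (∃ λ x → Comp (suc m) x₀ x × ¬ ∃ (In m x χ b)) →
      ∀ x → Comp (suc m) x₀ x → ∃ (In m x χ b)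
    inhabited {b} ∄ x cx = decidable-stable (anyVec? (In? m x χ b)) λ ne → ∄ (x , cx , ne)
    main : AtLeast (8 + 4 * k) (Cut (suc m) x₀ χ)
    main with full? false | full? true
    ... | yes (x , cx , full) | yes (y , cy , empty) = full-copies x₀ p₀ χ cx cy full empty
    ... | no ∄full | _ = no-full-copy x₀ p₀ χ (inhabited ∄full) ins
    ... | _ | no ∄empty = flip-cut (no-full-copy x₀ p₀ (not ∘ χ)
          (λ x cx → let y , i = inhabited ∄empty x cx in y , In-not {χ = χ} i)
          (let a , b , ne , ia , ib = outs in a , b , ne , In-not {χ = χ} ia , In-not {χ = χ} ib))

-- Base case of the cut bound: three movable positions

-- The six words of K₃,₃, the even permutations first.
arrangement : Fin 6 → Vec (Fin 3) 3
arrangement = lookup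
  ( (# 0 ∷ # 1 ∷ # 2 ∷ []) ∷ (# 1 ∷ # 2 ∷ # 0 ∷ []) ∷ (# 2 ∷ # 0 ∷ # 1 ∷ [])
  ∷ (# 1 ∷ # 0 ∷ # 2 ∷ []) ∷ (# 0 ∷ # 2 ∷ # 1 ∷ []) ∷ (# 2 ∷ # 1 ∷ # 0 ∷ []) ∷ [])

evens odds : List (Fin 6)
evens = # 0 ∷ # 1 ∷ # 2 ∷ []
odds  = # 3 ∷ # 4 ∷ # 5 ∷ []

-- Both orientations are listed because the colouring decides which of them counts as a cut arc.
K₃₃-arcs : List (Fin 6 × Fin 6)
K₃₃-arcs = cartesianProduct evens odds ++ cartesianProduct odds evens

K₃₃-cut? : ∀ v → (e : Fin 6 × Fin 6) → Dec (lookup v (proj₁ e) ≡ true × lookup v (proj₂ e) ≡ false)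
K₃₃-cut? v (i , j) = (lookup v i Bool.≟ true) ×-dec (lookup v j Bool.≟ false)

allBits? : ∀ {n} {P : Vec Bool n → Set} → (∀ v → Dec (P v)) → Dec (∀ v → P v)
allBits? {zero}  P? = map′ (λ { p [] → p }) (λ p → p []) (P? [])
allBits? {suc n} P? = map′ (λ { (f , t) (false ∷ v) → f v ; (f , t) (true ∷ v) → t v })
  (λ p → (λ v → p (false ∷ v)) , (λ v → p (true ∷ v)))
  (allBits? (P? ∘ (false ∷_)) ×-dec allBits? (P? ∘ (true ∷_)))

AtMostOne : Vec Bool 6 → Bool → Set
AtMostOne v b = ∀ i j → lookup v i ≡ b → lookup v j ≡ b → i ≡ j

abstract
  -- Decided by evaluation over all 64 colourings of the six vertices.
  K₃₃-bound : ∀ v → 4 ≤ length (filter (K₃₃-cut? v) K₃₃-arcs) ⊎ AtMostOne v true ⊎ AtMostOne v false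
  K₃₃-bound = from-yes (allBits? λ v →
    (4 ℕ.≤? length (filter (K₃₃-cut? v) K₃₃-arcs)) ⊎-dec atMostOne? v true ⊎-dec atMostOne? v false)
    where
    atMostOne? : ∀ v b → Dec (AtMostOne v b)
    atMostOne? v b = Fin.all? λ i → Fin.all? λ j →
      (lookup v i Bool.≟ b) →-dec ((lookup v j Bool.≟ b) →-dec (i Fin.≟ j))

  K₃₃-arcs-unique : Unique K₃₃-arcs
  K₃₃-arcs-unique = from-yes (unique? K₃₃-arcs)
    where open DecUnique (≡-dec Fin._≟_ Fin._≟_) using (unique?)

  arrangement-injective : ∀ i j → arrangement i ≡ arrangement j → i ≡ j
  arrangement-injective = from-yes (Fin.all? λ i → Fin.all? λ j →
    Vec.≡-dec Fin._≟_ (arrangement i) (arrangement j) →-dec (i Fin.≟ j))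

  arrangement-surjective : ∀ p q r → p ≢ q → p ≢ r → q ≢ r → ∃ λ i → arrangement i ≡ p ∷ q ∷ r ∷ []
  arrangement-surjective = from-yes (Fin.all? λ p → Fin.all? λ q → Fin.all? λ r →
    ¬? (p Fin.≟ q) →-dec (¬? (p Fin.≟ r) →-dec (¬? (q Fin.≟ r) →-dec
      Fin.any? λ i → Vec.≡-dec Fin._≟_ (arrangement i) (p ∷ q ∷ r ∷ []))))

module Base {n} (a b c : Fin (3 + n)) (rest : Vec (Fin (3 + n)) n) (p₀ : IsPerm (a ∷ b ∷ c ∷ rest)) where

  x₀ : Word (3 + n)
  x₀ = a ∷ b ∷ c ∷ rest

  abc : Vec (Fin (3 + n)) 3
  abc = a ∷ b ∷ c ∷ []

  word : Fin 6 → Word (3 + n)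
  word i = Vec.map (lookup abc) (arrangement i) Vec.++ rest

  -- On three positions all three transpositions are allowed, and each even arrangement reaches each
  -- odd one by exactly one of them.
  even-odd : ∀ {i j} → i ∈ evens → j ∈ odds → Nb 3 (word i) (word j)
  even-odd = λ
    { (here refl)                 (here refl)                 → 01-Nb
    ; (here refl)                 (there (here refl))         → 12-Nb
    ; (here refl)                 (there (there (here refl))) → 02-Nb
    ; (there (here refl))         (here refl)                 → 12-Nb
    ; (there (here refl))         (there (here refl))         → 02-Nb
    ; (there (here refl))         (there (there (here refl))) → 01-Nb
    ; (there (there (here refl))) (here refl)                 → 02-Nb
    ; (there (there (here refl))) (there (here refl))         → 01-Nb
    ; (there (there (here refl))) (there (there (here refl))) → 12-Nb }
    where
    01-Nb : ∀ {x : Word (3 + n)} → Nb 3 x (swap (# 0) (# 1) x)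
    01-Nb = # 0 , # 1 , inj₁ refl , s≤s (s≤s z≤n) , refl
    12-Nb : ∀ {x : Word (3 + n)} → Nb 3 x (swap (# 1) (# 2) x)
    12-Nb = # 1 , # 2 , inj₁ refl , ℕ.≤-refl , refl
    02-Nb : ∀ {x : Word (3 + n)} → Nb 3 x (swap (# 0) (# 2) x)
    02-Nb = # 0 , # 2 , inj₂ (refl , s≤s z≤n) , ℕ.≤-refl , refl

  arc-Nb : ∀ {i j} → (i , j) ∈ K₃₃-arcs → Nb 3 (word i) (word j)
  arc-Nb e∈ with ∈-++⁻ (cartesianProduct evens odds) e∈
  ... | inj₁ e∈′ = let i∈ , j∈ = ∈-cartesianProduct⁻ evens odds e∈′ in even-odd i∈ j∈
  ... | inj₂ e∈′ = let j∈ , i∈ = ∈-cartesianProduct⁻ odds evens e∈′ in Nb-sym (even-odd i∈ j∈)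

  word-Comp : ∀ i → Comp 3 x₀ (word i)
  word-Comp i with i ∈? evens | i ∈? odds
    where open DecMembership (Fin._≟_ {6}) using (_∈?_)
  -- The word numbered 0 is `x₀` by computation; the other even words are reached from it through
  -- the odd word numbered 3.
  ... | yes i∈ | _      = Comp-Nb (Comp-Nb (Comp-refl p₀) (even-odd (here refl) (here refl))) (Nb-sym (even-odd i∈ (here refl)))
  ... | no _   | yes i∈ = Comp-Nb (Comp-refl p₀) (even-odd (here refl) i∈)
  ... | no i∉  | no i∉′ = ⊥-elim ([ i∉ , i∉′ ]′ (∈-++⁻ evens (all∈ i)))
    where
    all∈ : ∀ i → i ∈ evens ++ odds
    all∈ = ∈-allFin

  abc-injective : ∀ {p q} → lookup abc p ≡ lookup abc q → p ≡ q
  abc-injective {p} {q} eq = Fin.↑ˡ-injective n p q (p₀ _ _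
    (trans (Vec.lookup-++ˡ abc rest p) (trans eq (sym (Vec.lookup-++ˡ abc rest q)))))

  word-injective : ∀ {i j} → word i ≡ word j → i ≡ j
  word-injective {i} {j} eq = arrangement-injective i j (lookup-ext λ p → abc-injective
    (trans (sym (Vec.lookup-map p (lookup abc) (arrangement i)))
      (trans (cong (λ v → lookup v p) (Vec.++-injectiveˡ (Vec.map (lookup abc) (arrangement i)) (Vec.map (lookup abc) (arrangement j)) eq))
        (Vec.lookup-map p (lookup abc) (arrangement j)))))

  word-surjective : ∀ {y} → Comp 3 x₀ y → ∃ λ i → y ≡ word i
  word-surjective {y₀ ∷ y₁ ∷ y₂ ∷ ys} cy = from-position
    (position (# 0) (s≤s z≤n)) (position (# 1) (s≤s (s≤s z≤n))) (position (# 2) ℕ.≤-refl)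
    where
    y = y₀ ∷ y₁ ∷ y₂ ∷ ys
    position : ∀ q → toℕ q < 3 → ∃ λ p → lookup abc p ≡ lookup y q
    position q q<3 with p , p<3 , eq ← Comp-position p₀ cy q<3 =
      fromℕ< p<3 , trans (sym (Vec.lookup-++ˡ abc rest (fromℕ< p<3))) (trans (cong (lookup x₀)
        (Fin.toℕ-injective (trans (Fin.toℕ-↑ˡ (fromℕ< p<3) n) (Fin.toℕ-fromℕ< p<3)))) eq)
    tail≡ : ys ≡ rest
    tail≡ = lookup-ext λ p → agree cy (suc (suc (suc p))) (s≤s (s≤s (s≤s z≤n)))
    distinct : ∀ {p q r s} → lookup abc p ≡ lookup y r → lookup abc q ≡ lookup y s → r ≢ s → p ≢ q
    distinct e f r≢s p≡q = r≢s (perm cy _ _ (trans (sym e) (trans (cong (lookup abc) p≡q) f)))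
    from-position : (∃ λ p → lookup abc p ≡ y₀) → (∃ λ p → lookup abc p ≡ y₁) → (∃ λ p → lookup abc p ≡ y₂) →
      ∃ λ i → y ≡ word i
    from-position (p , e) (q , f) (r , g) with arrangement-surjective p q r
      (distinct {r = # 0} {# 1} e f λ ()) (distinct {r = # 0} {# 2} e g λ ()) (distinct {r = # 1} {# 2} f g λ ())
    ... | i , eq rewrite tail≡ | sym e | sym f | sym g =
      i , cong (λ v → Vec.map (lookup abc) v Vec.++ rest) (sym eq)

  ¬two : ∀ χ {b} → AtMostOne (Vec.tabulate (χ ∘ word)) b → ¬ Two (In 3 x₀ χ b)
  ¬two χ ≤1 (s , s′ , s≢s′ , (c , e) , (c′ , e′)) with word-surjective c | word-surjective c′
  ... | i , refl | j , refl = s≢s′ (cong word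
    (≤1 i j (trans (Vec.lookup∘tabulate (χ ∘ word) i) e) (trans (Vec.lookup∘tabulate (χ ∘ word) j) e′)))

  bound : ∀ χ → Two (In 3 x₀ χ true) → Two (In 3 x₀ χ false) → AtLeast 4 (Cut 3 x₀ χ)
  bound χ ins outs with K₃₃-bound (Vec.tabulate (χ ∘ word))
  ... | inj₁ 4≤ = AtLeast-map (λ (i , j) → word i , word j)
    (λ _ _ eq → cong₂ _,_ (word-injective (,-injectiveˡ eq)) (word-injective (,-injectiveʳ eq)))
    (λ (i , j) (e∈ , i∈ , j∉) → cut (word-Comp i) (arc-Nb e∈)
      (trans (sym (Vec.lookup∘tabulate (χ ∘ word) i)) i∈) (trans (sym (Vec.lookup∘tabulate (χ ∘ word) j)) j∉))
    ( _ , Unique.filter⁺ (K₃₃-cut? v) K₃₃-arcs-unique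
    , All.tabulate (∈-filter⁻ (K₃₃-cut? v)) , 4≤)
    where
    v = Vec.tabulate (χ ∘ word)
  ... | inj₂ (inj₁ ≤1) = contradiction ins (¬two χ ≤1)
  ... | inj₂ (inj₂ ≤1) = contradiction outs (¬two χ ≤1)

Bound-zero : ∀ {n} → Bound (3 + n) 0
Bound-zero (a ∷ b ∷ c ∷ rest) χ p₀ = Base.bound a b c rest p₀ χ

-- Menger's theorem

AllPairs-lookup : ∀ {A : Set} {R : A → A → Set} → Symmetric R → ∀ {xs a b} → AllPairs R xs →
  a ∈ xs → b ∈ xs → a ≢ b → R a b
AllPairs-lookup s (rs ∷ _)  (here refl) (here refl) ne = contradiction refl ne
AllPairs-lookup s (rs ∷ _)  (here refl) (there q)   ne = All.lookup rs q
AllPairs-lookup s (rs ∷ _)  (there p)   (here refl) ne = s (All.lookup rs p)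
AllPairs-lookup s (_  ∷ rs) (there p)   (there q)   ne = AllPairs-lookup s rs p q ne

AllPairs-++⁻ : ∀ {A : Set} {R : A → A → Set} xs {ys} → AllPairs R (xs ++ ys) →
  AllPairs R ys × (∀ {a b} → a ∈ xs → b ∈ ys → R a b)
AllPairs-++⁻ []       rs       = rs , λ ()
AllPairs-++⁻ (x ∷ xs) (r ∷ rs) with AllPairs-++⁻ xs rs
... | ys , cross = ys , λ { (here refl) q → All.lookup r (∈-++⁺ʳ xs q) ; (there p) q → cross p q }

¬SameEdge-sym : ∀ {n} → Symmetric (λ (e e′ : Edge n) → ¬ SameEdge e e′)
¬SameEdge-sym ne (inj₁ (p , q)) = ne (inj₁ (sym p , sym q))
¬SameEdge-sym ne (inj₂ (p , q)) = ne (inj₂ (sym q , sym p))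

_≟ᵉ_ : ∀ {n} → DecidableEquality (Edge n)
_≟ᵉ_ = ≡-dec _≟ʷ_ _≟ʷ_

module _ {n : ℕ} where
  open DecMembership (_≟ʷ_ {n}) public using () renaming (_∈?_ to _∈ʷ?_)
  open DecMembership (_≟ᵉ_ {n}) public using () renaming (_∈?_ to _∈ᵉ?_)

AdjF? : ∀ {n} F (x y : Word n) → Dec (AdjF F x y)
AdjF? F x y = Adj? x y ×-dec ¬? (((x , y) ∈ᵉ? F) ⊎-dec ((y , x) ∈ᵉ? F))

AdjF-sym : ∀ {n} {F} {x y : Word n} → AdjF F x y → AdjF F y x
AdjF-sym (a , ok) = Adj-sym a , ok ∘ Sum.swap

outflow inflow : ∀ {n} → (Word n → ℕ) → List (Edge n) → ℕ
outflow f A = sum (map (f ∘ proj₁) A)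
inflow  f A = sum (map (f ∘ proj₂) A)

outflow-↭ : ∀ {n} (f : Word n → ℕ) {A B} → A ↭ B → outflow f A ≡ outflow f B
outflow-↭ f σ = sum-↭ (map⁺ _ σ)

inflow-↭ : ∀ {n} (f : Word n → ℕ) {A B} → A ↭ B → inflow f A ≡ inflow f B
inflow-↭ f σ = sum-↭ (map⁺ _ σ)

-- A carries m units of flow from u to v and one further unit from x to y. Conservation is tested
-- against every weighting f of the vertices, with both sides moved so that no subtraction occurs.
record Routing {n} (F : List (Edge n)) (u v : Word n) (m : ℕ) (x y : Word n) (A : List (Edge n)) : Set where
  constructor routing
  field
    arcs     : All (λ e → AdjF F (proj₁ e) (proj₂ e)) A
    disjoint : AllPairs (λ e e′ → ¬ SameEdge e e′) A
    balance  : ∀ f → outflow f A + (f y + m * f v) ≡ inflow f A + (f x + m * f u)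
open Routing

module _ {n} {F : List (Edge n)} {u v : Word n} where

  private
    exchange : ∀ a b c → a + (b + c) ≡ b + (a + c)
    exchange = solve-∀

  -- With equal ends the further unit cancels from the balance, so its base point is arbitrary.
  retarget : ∀ {m x A} z → Routing F u v m x x A → Routing F u v m z z A
  retarget {m} {x} {A} z r = routing (arcs r) (disjoint r) λ f → trans (exchange (outflow f A) (f z) _)
    (trans (cong (f z +_) (ℕ.+-cancelˡ-≡ (f x) _ _
      (trans (exchange (f x) (outflow f A) _) (trans (balance r f) (exchange (inflow f A) (f x) _)))))
    (exchange (f z) (inflow f A) _))

  absorb : ∀ {m A} → Routing F u v m u v A → Routing F u v (suc m) u u A
  absorb {m} {A} r = routing (arcs r) (disjoint r) λ f → trans (exchange (outflow f A) (f u) _)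
    (trans (cong (f u +_) (balance r f)) (exchange (f u) (inflow f A) _))

  release : ∀ {m A} → Routing F u v (suc m) u u A → Routing F u v m u v A
  release {m} {A} r = routing (arcs r) (disjoint r) λ f → ℕ.+-cancelˡ-≡ (f u) _ _
    (trans (exchange (f u) (outflow f A) _) (trans (balance r f) (exchange (inflow f A) (f u) _)))

  push : ∀ {m w x y A} → AdjF F x y → All (λ e → ¬ SameEdge (x , y) e) A →
    Routing F u v m w x A → Routing F u v m w y ((x , y) ∷ A)
  push {m} {w} {x} {y} {A} a d r = routing (a ∷ arcs r) (d ∷ disjoint r) λ f →
    trans (eq₁ (f x) (outflow f A) (f y) (m * f v)) (trans (cong (f y +_) (balance r f))
      (sym (ℕ.+-assoc (f y) (inflow f A) _)))
    where
    eq₁ : ∀ x o y v → x + o + (y + v) ≡ y + (o + (x + v))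
    eq₁ = solve-∀

  -- A residual step against the flow: cancelling the arc from `y` to `x` moves the end of the
  -- further unit from `x` back to `y`.
  unpush : ∀ {m w x y A B} → A ↭ (y , x) ∷ B → Routing F u v m w x A → Routing F u v m w y B
  unpush {m} {w} {x} {y} {A} {B} σ r with All-resp-↭ σ (arcs r) | AllPairs-resp-↭ ¬SameEdge-sym σ (disjoint r)
  ... | _ ∷ as | _ ∷ ds = routing as ds λ f → ℕ.+-cancelˡ-≡ (f x) _ _
    (trans (eq (f x) (outflow f B) (f y) (m * f v)) (trans (cong (_+ (f x + m * f v)) (sym (outflow-↭ f σ)))
      (trans (balance r f) (trans (cong (_+ (f w + m * f u)) (inflow-↭ f σ)) (ℕ.+-assoc (f x) (inflow f B) _)))))
    where
    eq : ∀ x o y v → x + (o + (y + v)) ≡ (y + o) + (x + v)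
    eq = solve-∀

  -- Removing an arc at the start of the further unit advances that start; `walk` peels off a route
  -- in this way.
  follow : ∀ {m x y z A B} → A ↭ (x , y) ∷ B → Routing F u v m x z A → Routing F u v m y z B
  follow {m} {x} {y} {z} {A} {B} σ r with All-resp-↭ σ (arcs r) | AllPairs-resp-↭ ¬SameEdge-sym σ (disjoint r)
  ... | _ ∷ as | _ ∷ ds = routing as ds λ f → ℕ.+-cancelˡ-≡ (f x) _ _
    (trans (sym (ℕ.+-assoc (f x) (outflow f B) _)) (trans (cong (_+ (f z + m * f v)) (sym (outflow-↭ f σ)))
      (trans (balance r f) (trans (cong (_+ (f x + m * f u)) (inflow-↭ f σ)) (eq (f y) (inflow f B) (f x) (m * f u))))))
    where
    eq : ∀ y i x u → (y + i) + (x + u) ≡ x + (i + (y + u))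
    eq = solve-∀

-- The vertices reached so far from u along residual arcs of A.
data Tree {n} (F A : List (Edge n)) (u : Word n) : List (Word n) → Set where
  root : Tree F A u (u ∷ [])
  grow : ∀ {R x y} → Tree F A u R → x ∈ R → AdjF F x y → (x , y) ∉ A → y ∉ R → Tree F A u (y ∷ R)

root∈ : ∀ {n} {F A : List (Edge n)} {u R} → Tree F A u R → u ∈ R
root∈ root             = here refl
root∈ (grow t _ _ _ _) = there (root∈ t)

-- Along a tree branch each step either cancels the opposite arc or adds a new one. The last
-- component is the invariant that keeps a new arc to `y` from being present already: it is not in
-- `A`, and `y` is not yet in the tree.
augment : ∀ {n} {F A : List (Edge n)} {u v m R y} → Routing F u v m u u A → Tree F A u R → y ∈ R →
  ∃ λ B → Routing F u v m u y B × (∀ {e} → e ∈ B → e ∈ A ⊎ proj₂ e ∈ R)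
augment r root (here refl) = _ , r , inj₁
augment r (grow t x∈R a ∉A y∉R) (there y∈R) with augment r t y∈R
... | B , r′ , sub = B , r′ , Sum.map₂ there ∘ sub
augment r (grow {x = x} {y} t x∈R a ∉A y∉R) (here refl) with augment r t x∈R
... | B , r′ , sub with (y , x) ∈ᵉ? B
...   | yes yx∈ with C , σ ← extract yx∈ =
  C , unpush σ r′ , λ e∈ → Sum.map₂ there (sub (∈-resp-↭ (↭-sym σ) (there e∈)))
...   | no yx∉ =
  (x , y) ∷ B ,
  push a (All.tabulate λ { e∈ (inj₁ (refl , refl)) → [ ∉A , y∉R ]′ (sub e∈) ; e∈ (inj₂ (refl , refl)) → yx∉ e∈ }) r′ ,
  λ { (here refl) → inj₂ (here refl) ; (there e∈) → Sum.map₂ there (sub e∈) }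

Closed : ∀ {n} (F A : List (Edge n)) → List (Word n) → Set
Closed F A R = ∀ {x y} → x ∈ R → AdjF F x y → (x , y) ∉ A → y ∈ R

search : ∀ {n} (F A : List (Edge n)) u → ∃ λ R → Tree F A u R × Closed F A R
search {n} F A u = go (length (allVecs n n)) root (allVecs n n) refl (inj₂ ∘ ∈-allVecs)
  where
  -- `U` contains every word not yet reached and loses one element per growth, so its length `k`
  -- bounds the search.
  go : ∀ k {R} → Tree F A u R → ∀ U → length U ≡ k → (∀ w → w ∈ R ⊎ w ∈ U) → ∃ λ R → Tree F A u R × Closed F A R
  go k {R} t U len cover with Any.any? (λ y → ¬? (y ∈ʷ? R) ×-dec Any.any? (λ x → AdjF? F x y ×-dec ¬? ((x , y) ∈ᵉ? A)) R) U
  ... | no stuck = R , t , λ {x} {y} x∈R a ∉A → decidable-stable (y ∈ʷ? R) λ y∉R →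
    [ y∉R , (λ y∈U → stuck (lose y∈U (y∉R , lose x∈R (a , ∉A)))) ]′ (cover y)
  go zero t [] len cover | yes ()
  go (suc k) {R} t U len cover | yes found with find found
  ... | y , y∈U , y∉R , fx with find fx | extract y∈U
  ...   | x , x∈R , a , ∉A | U′ , σ =
    go k (grow t x∈R a ∉A y∉R) U′ (ℕ.suc-injective (trans (sym (↭-length σ)) len)) cover′
    where
    cover′ : ∀ w → w ∈ y ∷ R ⊎ w ∈ U′
    cover′ w with cover w
    ... | inj₁ w∈R = inj₁ (there w∈R)
    ... | inj₂ w∈U with ∈-resp-↭ σ w∈U
    ...   | here refl = inj₁ (here refl)
    ...   | there w∈U′ = inj₂ w∈U′

-- No arc of `A` raises `f`, and every arc of `C` lowers it by at least one; the sum over `A` gives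
-- the bound.
net-outflow : ∀ {n} (f : Word n → ℕ) {A C : List (Edge n)} → (∀ {e} → e ∈ A → f (proj₂ e) ≤ f (proj₁ e)) →
  Unique C → (∀ {e} → e ∈ C → e ∈ A × f (proj₂ e) < f (proj₁ e)) → length C + inflow f A ≤ outflow f A
net-outflow f {[]}    mono [] C⊆A = z≤n
net-outflow f {e ∷ A} mono [] C⊆A = ℕ.+-mono-≤ (mono (here refl)) (net-outflow f (mono ∘ there) [] λ ())
net-outflow f {A} {c ∷ C} mono (c∉ ∷ uC) C⊆A with c∈A , lt ← C⊆A (here refl) with B , σ ← extract c∈A =
  begin
    suc (length C) + inflow f A                    ≡⟨ cong (suc (length C) +_) (inflow-↭ f σ) ⟩
    suc (length C) + (f (proj₂ c) + inflow f B)    ≡⟨ eq (length C) (f (proj₂ c)) (inflow f B) ⟩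
    suc (f (proj₂ c)) + (length C + inflow f B)    ≤⟨ ℕ.+-mono-≤ lt (net-outflow f (mono ∘ ∈-resp-↭ (↭-sym σ) ∘ there) uC
                                                        λ e∈ → let e∈A , l = C⊆A (there e∈) in
                                                          ∈-extract-≢ σ e∈A (≢-sym (All.lookup c∉ e∈)) , l) ⟩
    f (proj₁ c) + outflow f B                      ≡⟨ outflow-↭ f σ ⟨
    outflow f A ∎
  where
  open ℕ.≤-Reasoning
  eq : ∀ l a b → suc l + (a + b) ≡ suc a + (l + b)
  eq = solve-∀

indicator : ∀ {n} → List (Word n) → Word n → ℕ
indicator R w = if does (w ∈ʷ? R) then 1 else 0

indicator-∈ : ∀ {n} {R : List (Word n)} {w} → w ∈ R → indicator R w ≡ 1
indicator-∈ {R = R} {w} w∈ rewrite dec-true (w ∈ʷ? R) w∈ = refl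

indicator-∉ : ∀ {n} {R : List (Word n)} {w} → w ∉ R → indicator R w ≡ 0
indicator-∉ {R = R} {w} w∉ rewrite dec-false (w ∈ʷ? R) w∉ = refl

Leaving : ∀ {n} → List (Edge n) → (Word n → Bool) → Edge n → Set
Leaving F χ (x , y) = χ x ≡ true × χ y ≡ false × AdjF F x y

module _ {n} {F : List (Edge n)} {u v : Word n} where

  -- Closedness puts every edge leaving `R` into `A`, and no arc of `A` enters `R`, since its
  -- reverse would be residual. The net outflow from `R` is therefore at least the number of leaving
  -- edges, whereas the balance makes it `m`.
  closed⇒¬Leaving : ∀ {m A R} → Routing F u v m u u A → Closed F A R → u ∈ R → v ∉ R →
    ¬ AtLeast (suc m) (Leaving F (λ w → does (w ∈ʷ? R)))
  closed⇒¬Leaving {m} {A} {R} r closed u∈ v∉ (C , uC , ls , m<) = ℕ.<-irrefl (sym net) (begin-strict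
    inflow f A + m       ≡⟨ ℕ.+-comm (inflow f A) m ⟩
    m + inflow f A       <⟨ ℕ.+-monoˡ-≤ (inflow f A) m< ⟩
    length C + inflow f A ≤⟨ net-outflow f mono uC (λ e∈ → crossing (All.lookup ls e∈)) ⟩
    outflow f A          ∎)
    where
    open ℕ.≤-Reasoning
    f : Word n → ℕ
    f = indicator R
    -- The balance is tested against the indicator of `R`, which is 1 at `u` and 0 at `v`.
    net : outflow f A ≡ inflow f A + m
    net = ℕ.+-cancelʳ-≡ 1 _ _ (trans (eq (outflow f A) m) (trans (subst₂
      (λ a b → outflow f A + (a + m * b) ≡ inflow f A + (a + m * a)) (indicator-∈ u∈) (indicator-∉ v∉) (balance r f))
      (eq′ (inflow f A) m)))
      where
      eq : ∀ o m → o + 1 ≡ o + (1 + m * 0)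
      eq = solve-∀
      eq′ : ∀ i m → i + (1 + m * 1) ≡ i + m + 1
      eq′ = solve-∀
    mono : ∀ {e} → e ∈ A → f (proj₂ e) ≤ f (proj₁ e)
    mono {x , y} e∈ with y ∈ʷ? R
    ... | no _ = z≤n
    ... | yes y∈ = ℕ.≤-reflexive (sym (indicator-∈ (closed y∈ (AdjF-sym a) λ yx∈ →
      AllPairs-lookup ¬SameEdge-sym (disjoint r) e∈ yx∈ (proj₁ (proj₁ a) ∘ ,-injectiveˡ) (inj₂ (refl , refl)))))
      where
      a : AdjF F x y
      a = All.lookup (arcs r) e∈
    crossing : ∀ {e} → Leaving F (λ w → does (w ∈ʷ? R)) e → e ∈ A × f (proj₂ e) < f (proj₁ e)
    crossing {x , y} (x∈ , y∉ , a) with x ∈ʷ? R | y ∈ʷ? R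
    ... | yes x∈R | no y∉R =
      decidable-stable ((x , y) ∈ᵉ? A) (y∉R ∘ closed x∈R a) , s≤s z≤n

  -- Ford and Fulkerson's argument with one augmentation per unit: if the search misses `v`, the
  -- reached set is a cut with too few edges.
  max-flow : ∀ m → (∀ χ → χ u ≡ true → χ v ≡ false → AtLeast m (Leaving F χ)) → ∃ (Routing F u v m u u)
  max-flow zero    _  = [] , routing [] [] λ f → refl
  max-flow (suc m) cuts with max-flow m (λ χ χu χv → AtLeast-mono (ℕ.n≤1+n m) (λ _ l → l) (cuts χ χu χv))
  ... | A , r with search F A u
  ...   | R , t , closed with v ∈ʷ? R
  ...     | yes v∈ = let B , r′ , _ = augment r t v∈ in B , absorb r′
  ...     | no v∉  = contradiction
    (cuts (λ w → does (w ∈ʷ? R)) (dec-true (u ∈ʷ? R) (root∈ t)) (dec-false (v ∈ʷ? R) v∉))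
    (closed⇒¬Leaving r closed (root∈ t) v∉)

  walk : ∀ {m} k {x A} → length A ≡ k → Routing F u v m x v A →
    ∃ λ (W : Walk F x v) → ∃ λ B → A ↭ edges W ++ B × Routing F u v m v v B
  walk k {x} len r with x ≟ʷ v
  walk k {x} len r | yes refl = stop , _ , ↭-refl , r
  walk {m} k {x} {A} len r | no x≢v with Any.any? (λ e → proj₁ e ≟ʷ x) A
  -- With no arc out of `x`, the balance against the indicator of `x` has 0 on the left and a
  -- positive number on the right.
  walk {m} k {x} {A} len r | no x≢v | no ∄x = contradiction
    (trans (sym lhs≡0) (trans (balance r f) (trans (cong (λ a → inflow f A + (a + m * f u)) (indicator-∈ {R = x ∷ []} (here refl)))
      (ℕ.+-suc (inflow f A) (m * f u))))) λ ()
    where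
    f : Word n → ℕ
    f = indicator (x ∷ [])
    v∉ : v ∉ x ∷ []
    v∉ (here v≡x) = x≢v (sym v≡x)
    no-outflow : ∀ B → (∀ {e} → e ∈ B → proj₁ e ≢ x) → outflow f B ≡ 0
    no-outflow []      _  = refl
    no-outflow (e ∷ B) ne = cong₂ _+_ (indicator-∉ {R = x ∷ []} λ { (here eq) → ne (here refl) eq }) (no-outflow B (ne ∘ there))
    lhs≡0 : outflow f A + (f v + m * f v) ≡ 0
    lhs≡0 = cong₂ _+_ (no-outflow A λ e∈ eq → ∄x (lose e∈ eq))
      (trans (cong (λ a → a + m * a) (indicator-∉ v∉)) (ℕ.*-zeroʳ m))
  walk zero    {A = []} len r | no _ | yes ()
  walk (suc k) len r | no _ | yes found with find found
  ... | (x , y) , e∈ , refl with extract e∈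
  ...   | B , σ with walk k (ℕ.suc-injective (trans (sym (↭-length σ)) len)) (follow σ r)
  ...     | W , C , τ , r′ =
    step (All.lookup (arcs r) e∈) W , C , ↭-trans σ (prep _ τ) , r′

  Subpath : ∀ {x} → List (Edge n) → Set
  Subpath {x} es = ∃ λ (p : Path F x v) → ∀ {e} → e ∈ edges (proj₁ p) → e ∈ es

  cut-short : ∀ {x} y (p : Path F x v) → y ∈ vertices (proj₁ p) → Subpath {y} (edges (proj₁ p))
  cut-short y (stop , un)             (here refl) = (stop , un) , id
  cut-short y (step a w , un)         (here refl) = (step a w , un) , id
  cut-short y (step a w , _ ∷ un)     (there y∈)  = let p , sub = cut-short y (w , un) y∈ in p , there ∘ sub

  -- If the start recurs later, the path is restarted from that occurrence. Only arcs of the walk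
  -- survive, which preserves edge-disjointness.
  loop-erase : ∀ {x} (W : Walk F x v) → Subpath {x} (edges W)
  loop-erase stop = (stop , [] ∷ []) , id
  loop-erase {x} (step a W) with loop-erase W
  ... | (w , un) , sub with x ∈ʷ? vertices w
  ...   | yes x∈ = let p , sub′ = cut-short x (w , un) x∈ in p , there ∘ sub ∘ sub′
  ...   | no x∉  = (step a w , All.tabulate (λ { y∈ refl → x∉ y∈ }) ∷ un) ,
    λ { (here eq) → here eq ; (there e∈) → there (sub e∈) }

  flow-paths : ∀ m {A} → Routing F u v m u u A →
    ∃ λ (ps : List (Path F u v)) → length ps ≡ m × AllPairs EdgeDisjoint ps ×
      All (λ p → ∀ e → e ∈ edges (proj₁ p) → e ∈ A) ps
  flow-paths zero    r = [] , refl , [] , []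
  flow-paths (suc m) r with walk _ refl (release r)
  -- The traced unit leaves its arcs in `edges W`; the rest `B` still carries `m` units and, being
  -- closed at `v`, may be based at `u` again.
  ... | W , B , σ , r′ with flow-paths m (retarget u r′) | loop-erase W
                          | AllPairs-++⁻ (edges W) (AllPairs-resp-↭ ¬SameEdge-sym σ (disjoint r))
  ...   | ps , len , dis , subs | p , sub | _ , cross =
    p ∷ ps , cong suc len ,
    All.map (λ sub′ e e′ e∈ e′∈ → cross (sub e∈) (sub′ e′ e′∈)) subs ∷ dis ,
    (λ e e∈ → ∈-resp-↭ (↭-sym σ) (∈-++⁺ˡ (sub e∈))) ∷
    All.map (λ sub′ e e∈ → ∈-resp-↭ (↭-sym σ) (∈-++⁺ʳ (edges W) (sub′ e e∈))) subs

  menger : ∀ m → (∀ χ → χ u ≡ true → χ v ≡ false → AtLeast m (Leaving F χ)) →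
    ∃ λ (ps : List (Path F u v)) → length ps ≡ m × AllPairs EdgeDisjoint ps
  menger m cuts = let A , r = max-flow m cuts ; ps , len , dis , _ = flow-paths m r in ps , len , dis

-- Fault tolerance from the cut bound

isoperimetry : ∀ {n} k → 3 + k ≤ 3 + n → Bound (3 + n) k
isoperimetry zero    le = Bound-zero
isoperimetry (suc k) le = Step.Bound-suc k le (isoperimetry k (ℕ.<⇒≤ le))

perm⇒Comp : ∀ {n} {x y : Word n} → IsPerm y → Comp n x y
perm⇒Comp py = comp py λ p n≤p → contradiction (Fin.toℕ<n p) (ℕ.≤⇒≯ n≤p)

-- Each fault destroys at most one arc of `P`: as these arcs run from `true` to `false`, the colour
-- of `a` decides which orientation of the fault could occur.
avoid-faults : ∀ {n k} {P : Edge n → Set} (F : List (Edge n)) (χ : Colouring n) →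
  (∀ {x y} → P (x , y) → χ x ≡ true × χ y ≡ false) → AtLeast (length F + k) P →
  AtLeast k (λ e → P e × ¬ Faulty F (proj₁ e) (proj₂ e))
avoid-faults []            χ crosses = AtLeast-mono ℕ.≤-refl λ _ p → p , λ { (inj₁ ()) ; (inj₂ ()) }
avoid-faults {P = P} ((a , b) ∷ F) χ crosses L with χ a in χa
... | true = AtLeast-mono ℕ.≤-refl ok (avoid-faults F χ (crosses ∘ proj₁) (AtLeast-remove _≟ᵉ_ (a , b) L))
  where
  ok : ∀ e → (P e × e ≢ (a , b)) × ¬ Faulty F (proj₁ e) (proj₂ e) → P e × ¬ Faulty ((a , b) ∷ F) (proj₁ e) (proj₂ e)
  ok e ((p , ne) , ok) = p , λ
    { (inj₁ (here eq))   → ne eq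
    ; (inj₁ (there e∈))  → ok (inj₁ e∈)
    ; (inj₂ (here refl)) → contradiction (trans (sym χa) (proj₂ (crosses p))) λ ()
    ; (inj₂ (there e∈))  → ok (inj₂ e∈) }
... | false = AtLeast-mono ℕ.≤-refl ok (avoid-faults F χ (crosses ∘ proj₁) (AtLeast-remove _≟ᵉ_ (b , a) L))
  where
  ok : ∀ e → (P e × e ≢ (b , a)) × ¬ Faulty F (proj₁ e) (proj₂ e) → P e × ¬ Faulty ((a , b) ∷ F) (proj₁ e) (proj₂ e)
  ok e ((p , ne) , ok) = p , λ
    { (inj₁ (here refl)) → contradiction (trans (sym χa) (proj₁ (crosses p))) λ ()
    ; (inj₁ (there e∈))  → ok (inj₁ e∈)
    ; (inj₂ (here refl)) → ne refl
    ; (inj₂ (there e∈))  → ok (inj₂ e∈) }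

length-neighbours : ∀ {n} k (le : 2 + k ≤ 2 + n) x → length (neighbours k le x) ≡ 1 + 2 * k
length-neighbours k le x = cong suc (length-extra k le x)

Degree-≤ : ∀ {n F d} {x : Word (2 + n)} → Degree F x d → d ≤ 1 + 2 * n
Degree-≤ {n} {x = x} (L , uL , refl , spec) = subst (length L ≤_) (length-neighbours n ℕ.≤-refl x)
  (Unique-⊆⇒length≤ uL λ y∈ → ∈-neighbours⁺ n ℕ.≤-refl (Adj⇒Nb (proj₁ (proj₁ (spec _) y∈))))

-- With n = 3 + `N`, the number 2n - 5 is `1 + 2 * N`, the full degree 2n - 3 is `3 + 2 * N`, and 4n
-- - 8 is `4 + 4 * N`.
fault-tolerance : ∀ N (F : List (Edge (3 + N))) → length F ≤ 1 + 2 * N → StronglyMengerEC (3 + N) F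
fault-tolerance N F small u v pu pv u≢v du dv Du@(Lu , uniqueᵤ , lenᵤ , specᵤ) (Lv , uniqueᵥ , lenᵥ , specᵥ) =
  menger (du ⊓ dv) cuts
  where
  cuts : ∀ χ → χ u ≡ true → χ v ≡ false → AtLeast (du ⊓ dv) (Leaving F χ)
  cuts χ χu χv
    with anyVec? (λ y → ¬? (y ≟ʷ u) ×-dec In? (3 + N) u χ true y)
       | anyVec? (λ y → ¬? (y ≟ʷ v) ×-dec In? (3 + N) u χ false y)
  ... | yes (s , s≢u , is) | yes (t , t≢v , it) =
    AtLeast-mono (ℕ.≤-trans (ℕ.m⊓n≤m du dv) (subst (du ≤_) (cong suc (ℕ.*-suc 2 N)) (Degree-≤ Du)))
      (λ e (c , ok) → inside c , outside c , Nb⇒Adj (perm (source c)) (nb c) , ok)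
      (avoid-faults F χ (λ c → inside c , outside c)
        (AtLeast-mono (subst (length F + (3 + 2 * N) ≤_) (eq N) (ℕ.+-monoˡ-≤ (3 + 2 * N) small)) (λ _ c → c)
          (isoperimetry N ℕ.≤-refl u χ pu (s , u , s≢u , is , perm⇒Comp pu , χu) (t , v , t≢v , it , perm⇒Comp pv , χv))))
    where
    eq : ∀ N → (1 + 2 * N) + (3 + 2 * N) ≡ 4 + 4 * N
    eq = solve-∀
  ... | no ∄s | _ =
    AtLeast-mono (ℕ.m⊓n≤m du dv) (λ _ l → l)
      (AtLeast-map {P = AdjF F u} {Q = Leaving F χ} (u ,_) (λ _ _ → ,-injectiveʳ)
        (λ y a → χu , Bool.¬-not (λ i → ∄s (y , ≢-sym (proj₁ (proj₁ a)) , perm⇒Comp (Adj-perm pu (proj₁ a)) , i)) , a)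
        (Lu , uniqueᵤ , All.tabulate (λ {y} → proj₁ (specᵤ y)) , ℕ.≤-reflexive (sym lenᵤ)))
  ... | _ | no ∄t =
    AtLeast-mono (ℕ.m⊓n≤n du dv) (λ _ l → l)
      (AtLeast-map {P = AdjF F v} {Q = Leaving F χ} (_, v) (λ _ _ → ,-injectiveˡ)
        (λ y a → Bool.¬-not (λ i → ∄t (y , ≢-sym (proj₁ (proj₁ a)) , perm⇒Comp (Adj-perm pv (proj₁ a)) , i)) , χv , AdjF-sym a)
        (Lv , uniqueᵥ , All.tabulate (λ {y} → proj₁ (specᵥ y)) , ℕ.≤-reflexive (sym lenᵥ)))

-- All edges at w are faulty except the one to u: a path from u through w cannot continue,
-- so the full degree of u is not available.
module Sharpness (N : ℕ) where

  -- `v` differs from the identity `w` in three positions, so it is not a neighbour of `w`. Hence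
  -- `u` and `v` both keep their full degree while `w` retains only its edge to `u`.
  w u v : Word (3 + N)
  w = Vec.allFin (3 + N)
  u = swap (# 0) (# 1) w
  v = swap (# 0) (# 2) u

  pw : IsPerm w
  pw i j eq = trans (sym (Vec.lookup-allFin i)) (trans eq (Vec.lookup-allFin j))

  pu : IsPerm u
  pu = swap-perm (# 0) (# 1) w pw

  pv : IsPerm v
  pv = swap-perm (# 0) (# 2) u pu

  lost : List (Word (3 + N))
  lost = extra (1 + N) ℕ.≤-refl w

  F : List (Edge (3 + N))
  F = map (w ,_) lost

  ∈-lost⇒Nb : ∀ {y} → y ∈ lost → Nb (3 + N) w y
  ∈-lost⇒Nb y∈ = ∈-neighbours⁻ (1 + N) ℕ.≤-refl (there y∈)

  F-faults : FaultSet F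
  F-faults = All.map⁺ (All.tabulate λ y∈ → pw , Nb⇒Adj pw (∈-lost⇒Nb y∈))

  F-distinct : NoDupEdges F
  F-distinct = AllPairs.map⁺ (AllPairs.map distinct (AllPairs.tail (neighbours-unique (1 + N) ℕ.≤-refl pw)))
    where
    distinct : ∀ {y z} → y ≢ z → ¬ SameEdge (w , y) (w , z)
    distinct ne (inj₁ (_ , eq))   = ne eq
    distinct ne (inj₂ (eq , eq′)) = ne (trans eq′ eq)

  length-F : length F ≡ 2 * (1 + N)
  length-F = trans (length-map {B = Edge (3 + N)} (w ,_) lost) (length-extra (1 + N) ℕ.≤-refl w)

  ¬Nb-w-v : ¬ Nb (3 + N) w v
  ¬Nb-w-v (i , j , _ , _ , eq) = three-moved (moved (# 0) λ ()) (moved (# 1) λ ()) (moved (# 2) λ ())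
    where
    moved : ∀ p → lookup v p ≢ lookup w p → p ≡ i ⊎ p ≡ j
    moved p ne with p Fin.≟ i | p Fin.≟ j
    ... | yes p≡i | _       = inj₁ p≡i
    ... | no _    | yes p≡j = inj₂ p≡j
    ... | no p≢i  | no p≢j  = contradiction (trans (cong (λ x → lookup x p) eq) (lookup-swap-≢ i j w p≢i p≢j)) ne
    three-moved : # 0 ≡ i ⊎ # 0 ≡ j → # 1 ≡ i ⊎ # 1 ≡ j → # 2 ≡ i ⊎ # 2 ≡ j → ⊥
    three-moved (inj₁ refl) (inj₂ refl) (inj₁ ())
    three-moved (inj₁ refl) (inj₂ refl) (inj₂ ())
    three-moved (inj₂ refl) (inj₁ refl) (inj₁ ())
    three-moved (inj₂ refl) (inj₁ refl) (inj₂ ())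

  full-degree : ∀ {x} → IsPerm x → x ≢ w → x ∉ lost → Degree F x (3 + 2 * N)
  full-degree {x} px x≢w x∉ =
    neighbours (1 + N) ℕ.≤-refl x , neighbours-unique (1 + N) ℕ.≤-refl px ,
    trans (length-neighbours (1 + N) ℕ.≤-refl x) (cong suc (ℕ.*-suc 2 N)) ,
    λ y → (λ y∈ → Nb⇒Adj px (∈-neighbours⁻ (1 + N) ℕ.≤-refl y∈) , ok) ,
          λ (a , _) → ∈-neighbours⁺ (1 + N) ℕ.≤-refl (Adj⇒Nb a)
    where
    ok : ∀ {y} → ¬ Faulty F x y
    ok (inj₁ e∈) with _ , _ , eq ← ∈-map⁻ (w ,_) e∈ = x≢w (,-injectiveˡ eq)
    ok (inj₂ e∈) with _ , y∈ , eq ← ∈-map⁻ (w ,_) e∈ = x∉ (subst (_∈ lost) (sym (,-injectiveʳ eq)) y∈)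

  u≢w : u ≢ w
  u≢w = ≢-sym (swap-≢ {i = # 0} {# 1} w pw λ ())

  u≢v : u ≢ v
  u≢v = swap-≢ {i = # 0} {# 2} u pu λ ()

  v≢w : v ≢ w
  v≢w eq = contradiction (cong (λ x → lookup x (# 0)) eq) λ ()

  -- The case `stop` is excluded by unification, since the first entries of `u` and `v` compute to
  -- different values.
  first : Path F u v → Word (3 + N)
  first (step {w = y} _ _ , _) = y

  first∈ : ∀ p → (u , first p) ∈ edges (proj₁ p)
  first∈ (step _ _ , _) = here refl

  first-AdjF : ∀ p → AdjF F u (first p)
  first-AdjF (step a _ , _) = a

  vertices-head : ∀ {x} (W : Walk F x v) → x ∈ vertices W
  vertices-head stop       = here refl
  vertices-head (step _ _) = here refl

  -- From `w` a path could only return to `u`, which it has already visited, or use a fault; it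
  -- cannot end there because `w` is not `v`.
  first≢w : ∀ p → first p ≢ w
  first≢w (step _ stop , _) eq = v≢w eq
  first≢w (step _ (step {w = y} (a , ok) W) , (u∉ ∷ _)) refl with ∈-neighbours⁺ (1 + N) ℕ.≤-refl (Adj⇒Nb a)
  ... | here refl = All.lookup u∉ (there (vertices-head W)) refl
  ... | there y∈  = ok (inj₁ (∈-map⁺ (w ,_) y∈))

  -- Edge-disjoint paths have distinct first vertices. Together with `w` these would be 2n - 2
  -- distinct neighbours of `u`, which has only 2n - 3.
  not-Menger : ¬ StronglyMengerEC (3 + N) F
  not-Menger sm with sm u v pu pv u≢v _ _ (full-degree pu u≢w u∉lost) (full-degree pv v≢w (¬Nb-w-v ∘ ∈-lost⇒Nb))
    where
    u∉lost : u ∉ lost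
    u∉lost = Unique.Unique[x∷xs]⇒x∉xs (neighbours-unique (1 + N) ℕ.≤-refl pw)
  ... | ps , len , dis = ℕ.1+n≰n (subst₂ (λ a b → suc a ≤ b)
    (trans (length-map first ps) (trans len (ℕ.⊓-idem _)))
    (trans (length-neighbours (1 + N) ℕ.≤-refl u) (cong suc (ℕ.*-suc 2 N)))
    (Unique-⊆⇒length≤ (All.map⁺ (All.tabulate λ {p} _ → ≢-sym (first≢w p)) ∷ firsts-unique) ⊆nbs))
    where
    firsts-unique : Unique (map first ps)
    firsts-unique = AllPairs.map⁺ (AllPairs.map
      (λ {p} {q} dis eq → dis _ _ (first∈ p) (first∈ q) (inj₁ (refl , eq))) dis)
    ⊆nbs : ∀ {y} → y ∈ w ∷ map first ps → y ∈ neighbours (1 + N) ℕ.≤-refl u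
    ⊆nbs (here refl) = ∈-neighbours⁺ (1 + N) ℕ.≤-refl (Nb-sym (∈-neighbours⁻ (1 + N) ℕ.≤-refl (here refl)))
    ⊆nbs (there y∈) with p , _ , refl ← ∈-map⁻ first y∈ =
      ∈-neighbours⁺ (1 + N) ℕ.≤-refl (Adj⇒Nb (proj₁ (first-AdjF p)))

theorem3p1 : (n : ℕ) → 3 ≤ n →
    ((F : List (Edge n)) → FaultSet F → length F ≤ 2 * n ∸ 5 → StronglyMengerEC n F)
    × Σ (List (Edge n)) (λ F → FaultSet F × NoDupEdges F × length F ≡ 2 * n ∸ 4 × ¬ StronglyMengerEC n F)
theorem3p1 (suc (suc (suc N))) (s≤s (s≤s (s≤s z≤n))) =
  (λ F _ small → fault-tolerance N F (subst (length F ≤_) (cong (_∸ 5) (eq N)) small)) ,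
  F , F-faults , F-distinct , trans length-F (cong (_∸ 4) (eq′ N)) , not-Menger
  where
  open Sharpness N
  eq : ∀ N → 2 * (3 + N) ≡ 5 + (1 + 2 * N)
  eq = solve-∀
  eq′ : ∀ N → 4 + 2 * (1 + N) ≡ 2 * (3 + N)
  eq′ = solve-∀
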